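{- Every $3$-edge-connected graph $G$ satisfies $fn(G)\le 4$.
   Context: All graphs are finite. An orientation $(G,o)$ of a graph $G$ assigns to each edge one of its two directions. An orientation is strong if for every ordered pair of distinct vertices $u,v$ there is a directed $uv$-path. An edge $e$ is deletable in an orientation $(G,o)$ if the restriction of $o$ to $E(G)\setminus\{e\}$ is a strong orientation of $G-e$. For a $3$-edge-connected graph $G$, the Frank number $fn(G)$ is the minimum number $k$ such that $G$ admits $k$ orientations with the property that every edge of $G$ is deletable in at least one of them. -}

module Defs where

open import Data.Bool using (Bool; true; false)
open import Data.Fin using (Fin)
open import Data.Fin.Subset using (Subset; _∈_; ∣_∣; ∁; ⁅_⁆)
open import Data.Nat using (ℕ; _≤_; _<_)
open import Data.Product using (_×_; ∃-syntax; _,_; swap)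
open import Data.Sum using (_⊎_)
open import Data.Vec using (Vec; lookup)
open import Data.Vec.Relation.Unary.Any using (Any)
open import Relation.Binary.Construct.Closure.ReflexiveTransitive using (Star)
open import Relation.Binary.PropositionalEquality using (_≡_; _≢_)

-- Finite graphs; parallel edges and loops are allowed.  The order of the two
-- ends of an edge carries no meaning: it is only a reference against which
-- directions are recorded.
record Graph : Set where
  field
    order : ℕ
    size  : ℕ
    ends  : Fin size → Fin order × Fin order

  Vertex : Set
  Vertex = Fin order

  Edge : Set
  Edge = Fin size

  EdgeSet : Set
  EdgeSet = Subset size

open Graph public

-- A set F of edges stands for the spanning subgraph (V(G), F); thus G - X is
-- represented by ∁ X.
Adjacent : (G : Graph) → EdgeSet G → Vertex G → Vertex G → Set
Adjacent G F u v =
  ∃[ e ] (e ∈ F × (ends G e ≡ (u , v) ⊎ ends G e ≡ (v , u)))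

-- Elements of Star are walks; a walk between two vertices exists exactly when
-- a path does.
Connected : (G : Graph) → EdgeSet G → Set
Connected G F = ∀ u v → Star (Adjacent G F) u v

EdgeConnected : ℕ → Graph → Set
EdgeConnected k G = (X : EdgeSet G) → ∣ X ∣ < k → Connected G (∁ X)

-- One direction per edge: true keeps the reference order of the ends, false
-- reverses it.
Orientation : Graph → Set
Orientation G = Vec Bool (size G)

direct : {A : Set} → Bool → A × A → A × A
direct true  p = p
direct false p = swap p

-- The pair (tail , head) of e.
arc : (G : Graph) → Orientation G → Edge G → Vertex G × Vertex G
arc G o e = direct (lookup o e) (ends G e)

Arc : (G : Graph) → EdgeSet G → Orientation G → Vertex G → Vertex G → Set
Arc G F o u v = ∃[ e ] (e ∈ F × arc G o e ≡ (u , v))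

-- The restriction of o to F is a strong orientation of (V(G), F).
Strong : (G : Graph) → EdgeSet G → Orientation G → Set
Strong G F o = ∀ u v → u ≢ v → Star (Arc G F o) u v

Deletable : (G : Graph) → Orientation G → Edge G → Set
Deletable G o e = Strong G (∁ ⁅ e ⁆) o

AdmitsFrankFamily : Graph → ℕ → Set
AdmitsFrankFamily G k =
  ∃[ os ] (∀ (e : Edge G) → Any (λ o → Deletable G o e) {n = k} os)

-- fn(G) = k, as a relation: k is the least size of such a family.
IsFrankNumber : Graph → ℕ → Set
IsFrankNumber G k =
  AdmitsFrankFamily G k × (∀ j → AdmitsFrankFamily G j → k ≤ j)

{-# OPTIONS --safe #-}

-- If f is a nowhere-zero integer circulation, orient every edge in the
-- direction in which f is positive.  An edge with |f| = 1 is then deletable: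
-- were it alone in its direction across some cut, conservation would leave at
-- most one edge in the other direction, against 3-edge-connectivity.  So it
-- suffices to find four nowhere-zero circulations such that every edge has
-- value ±1 in one of them.
--
-- As in Seymour's 6-flow theorem there are circulations g with values 0, ±1
-- and f such that g ≠ 0 or 3 ∤ f on every edge: grow a connected subgraph,
-- adding an edge, or two edges and a connected even subgraph (carrying g)
-- that meets both; then, in reverse order, correct f modulo 3 on the one or
-- two edges added, using a circulation through them within the subgraph
-- reached at that stage.  Reducing f modulo 3 gives h with |h| ≤ 2,
-- and rounding h / 2 gives z with |h − 2z| ≤ 1.  The circulations g + 2h,
-- 3g + h, 3g − 2h and 2g − 4h + 7z are as required.

module Submission where

import Algebra.Properties.CommutativeMonoid.Sum as MonoidSum
import Algebra.Properties.Semiring.Sum as SemiringSum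
open import Data.Bool using (Bool; true; false; not; if_then_else_)
open import Data.Bool.Properties using () renaming (_≟_ to _≟ᵇ_)
open import Data.Empty using (⊥; ⊥-elim)
open import Data.Fin using (Fin; zero; suc; _≟_)
open import Data.Fin.Properties using (all?; any?)
open import Data.Fin.Subset
  using (Subset; _∈_; _∉_; _⊆_; _⊂_; _⊃_; _∪_; _∩_; ⁅_⁆; ∁; ∣_∣)
  renaming (⊥ to ∅)
open import Data.Fin.Subset.Induction using (⊃-wellFounded; ⊂-wellFounded; Acc; acc)
open import Data.Fin.Subset.Properties
open import Data.Integer as ℤ using (ℤ; +_; -[1+_]; 0ℤ; 1ℤ; _+_; _-_; _*_; -_)
import Data.Integer.Divisibility.Signed as Div
import Data.Integer.Properties as ℤ
open import Data.Integer.Tactic.RingSolver using (solve-∀)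
open import Data.Nat as ℕ using (ℕ; zero; suc; _≤_; _<_; z≤n; s≤s; _∸_)
open import Data.Nat.Induction using (<-wellFounded)
import Data.Nat.Properties as ℕ
open import Data.Product using (_×_; _,_; ∃-syntax; proj₁; proj₂)
open import Data.Sum using (_⊎_; inj₁; inj₂)
open import Data.Unit using (⊤; tt)
open import Data.Vec using (Vec; []; _∷_; lookup; replicate; tabulate)
open import Data.Vec.Properties using (lookup∘tabulate; lookup⇒[]=; []=⇒lookup)
open import Data.Vec.Relation.Unary.Any as Any using (Any; here; there)
open import Function using (_∘_)
open import Relation.Binary.Construct.Closure.ReflexiveTransitive
  using (Star; ε; _◅_; _◅◅_; map)
open import Relation.Binary.PropositionalEquality
open import Relation.Nullary
  using (¬_; Dec; yes; no; does; ¬?; _×-dec_; _⊎-dec_; _→-dec_)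
import Relation.Nullary.Decidable as Dec
open import Defs
open MonoidSum ℕ.+-0-commutativeMonoid using () renaming (sum to sumℕ)
open SemiringSum ℤ.+-*-semiring
  using (sum; sum-cong-≗; ∑-distrib-+; *-distribˡ-sum; sum-replicate-zero)

-- Sums of integers, and signs.

sum-0≤ : ∀ {n} (c : Fin n → ℤ) → (∀ i → 0ℤ ℤ.≤ c i) → 0ℤ ℤ.≤ sum c
sum-0≤ {zero}  c c≥0 = ℤ.≤-refl
sum-0≤ {suc n} c c≥0 = ℤ.+-mono-≤ (c≥0 zero) (sum-0≤ (c ∘ suc) (c≥0 ∘ suc))

term≤sum : ∀ {n} (c : Fin n → ℤ) → (∀ i → 0ℤ ℤ.≤ c i) → ∀ i → c i ℤ.≤ sum c
term≤sum c c≥0 zero =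
  subst (ℤ._≤ sum c) (ℤ.+-identityʳ (c zero))
    (ℤ.+-monoʳ-≤ (c zero) (sum-0≤ (c ∘ suc) (c≥0 ∘ suc)))
term≤sum c c≥0 (suc i) =
  subst (ℤ._≤ sum c) (ℤ.+-identityˡ (c (suc i)))
    (ℤ.+-mono-≤ (c≥0 zero) (term≤sum (c ∘ suc) (c≥0 ∘ suc) i))

pair≤sum : ∀ {n} (c : Fin n → ℤ) → (∀ i → 0ℤ ℤ.≤ c i) →
           ∀ i j → i ≢ j → c i + c j ℤ.≤ sum c
pair≤sum c c≥0 zero zero i≢j = ⊥-elim (i≢j refl)
pair≤sum c c≥0 zero (suc j) _ =
  ℤ.+-monoʳ-≤ (c zero) (term≤sum (c ∘ suc) (c≥0 ∘ suc) j)
pair≤sum c c≥0 (suc i) zero _ =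
  subst (ℤ._≤ sum c) (ℤ.+-comm (c zero) (c (suc i)))
    (ℤ.+-monoʳ-≤ (c zero) (term≤sum (c ∘ suc) (c≥0 ∘ suc) i))
pair≤sum c c≥0 (suc i) (suc j) i≢j =
  subst (ℤ._≤ sum c) (ℤ.+-identityˡ _)
    (ℤ.+-mono-≤ (c≥0 zero)
      (pair≤sum (c ∘ suc) (c≥0 ∘ suc) i j (i≢j ∘ cong suc)))

sum-zero : ∀ {n} (c : Fin n → ℤ) → (∀ i → c i ≡ 0ℤ) → sum c ≡ 0ℤ
sum-zero {n} c c≡0 = trans (sum-cong-≗ c≡0) (sum-replicate-zero n)

sum-only : ∀ {n} (c : Fin n → ℤ) i → (∀ j → j ≢ i → c j ≡ 0ℤ) → sum c ≡ c i
sum-only c zero c≡0 =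
  trans (cong₂ _+_ {c zero} refl (sum-zero (c ∘ suc) (λ j → c≡0 (suc j) λ ())))
    (ℤ.+-identityʳ (c zero))
sum-only c (suc i) c≡0 =
  trans (cong₂ _+_ (c≡0 zero λ ())
          (sum-only (c ∘ suc) i (λ j j≢i → c≡0 (suc j) (λ { refl → j≢i refl }))))
    (ℤ.+-identityˡ (c (suc i)))

sgn : Bool → ℤ
sgn true  = 1ℤ
sgn false = ℤ.-1ℤ

sgn*sgn : ∀ d → sgn d * sgn d ≡ 1ℤ
sgn*sgn true  = refl
sgn*sgn false = refl

1a+1·0 : ∀ {a b} → b ≡ 0ℤ → 1ℤ * a + 1ℤ * b ≡ a
1a+1·0 {a} refl = trans (ℤ.+-identityʳ _) (ℤ.*-identityˡ a)

1·0+1b : ∀ {a b} → a ≡ 0ℤ → 1ℤ * a + 1ℤ * b ≡ b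
1·0+1b {b = b} refl = trans (ℤ.+-identityˡ _) (ℤ.*-identityˡ b)

-- Chains, circulations, and flows between two vertices.

module Flux (G : Graph) where

  Chain : Set
  Chain = Edge G → ℤ

  Potential : Set
  Potential = Vertex G → ℤ

  src tgt : Edge G → Vertex G
  src e = proj₁ (ends G e)
  tgt e = proj₂ (ends G e)

  -- A pair `d`, `e` is a dart: the edge traversed along its reference order if `d` is `true`,
  -- against it otherwise. The value of a chain `f` in that direction is `sgn d * f e`.
  tl hd : Bool → Edge G → Vertex G
  tl d e = proj₁ (direct d (ends G e))
  hd d e = proj₂ (direct d (ends G e))

  Δ : Potential → Edge G → ℤ
  Δ p e = p (tgt e) - p (src e)

  -- Pairing with every potential instead of computing the boundary at every
  -- vertex: the net flow across a cut is the case of an indicator function.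
  flux : Chain → Potential → ℤ
  flux f p = sum (λ e → f e * Δ p e)

  Circulation : Chain → Set
  Circulation f = ∀ p → flux f p ≡ 0ℤ

  -- A flow of value `k` from `x` to `y`: the boundary is `k` times y minus x, again tested by
  -- potentials.
  Carries : Chain → ℤ → Vertex G → Vertex G → Set
  Carries f k x y = ∀ p → flux f p ≡ k * (p y - p x)

  combine : ℤ → Chain → ℤ → Chain → Chain
  combine a f b g e = a * f e + b * g e

  flux-combine : ∀ a f b g p →
                 flux (combine a f b g) p ≡ a * flux f p + b * flux g p
  flux-combine a f b g p = begin
    sum (λ e → (a * f e + b * g e) * Δ p e)
      ≡⟨ sum-cong-≗ (λ e → expand a (f e) b (g e) (Δ p e)) ⟩
    sum (λ e → a * (f e * Δ p e) + b * (g e * Δ p e))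
      ≡⟨ ∑-distrib-+ (λ e → a * (f e * Δ p e)) (λ e → b * (g e * Δ p e)) ⟩
    sum (λ e → a * (f e * Δ p e)) + sum (λ e → b * (g e * Δ p e))
      ≡⟨ cong₂ _+_ (*-distribˡ-sum a (λ e → f e * Δ p e))
                   (*-distribˡ-sum b (λ e → g e * Δ p e)) ⟨
    a * flux f p + b * flux g p ∎
    where
    open ≡-Reasoning
    expand : ∀ a x b y z → (a * x + b * y) * z ≡ a * (x * z) + b * (y * z)
    expand = solve-∀

  circulation-combine : ∀ a f b g → Circulation f → Circulation g →
                        Circulation (combine a f b g)
  circulation-combine a f b g cf cg p = begin
    flux (combine a f b g) p     ≡⟨ flux-combine a f b g p ⟩
    a * flux f p + b * flux g p  ≡⟨ cong₂ (λ x y → a * x + b * y) (cf p) (cg p) ⟩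
    a * 0ℤ + b * 0ℤ              ≡⟨ cong₂ _+_ (ℤ.*-zeroʳ a) (ℤ.*-zeroʳ b) ⟩
    0ℤ                           ∎
    where open ≡-Reasoning

  circulation-zero : Circulation (λ _ → 0ℤ)
  circulation-zero p = sum-zero _ (λ e → ℤ.*-zeroˡ (Δ p e))

  carries-zero : ∀ {x} → Carries (λ _ → 0ℤ) 1ℤ x x
  carries-zero {x} p =
    trans (circulation-zero p) (sym (trans (ℤ.*-identityˡ _) (ℤ.+-inverseʳ (p x))))

  Δ-dart : ∀ p d e → Δ p e ≡ sgn d * (p (hd d e) - p (tl d e))
  Δ-dart p true  e = sym (ℤ.*-identityˡ _)
  Δ-dart p false e = swap-sign (p (tgt e)) (p (src e))
    where
    swap-sign : ∀ a b → a - b ≡ ℤ.-1ℤ * (b - a)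
    swap-sign = solve-∀

  unit : Bool → Edge G → Chain
  unit d e e′ = if does (e ≟ e′) then sgn d else 0ℤ

  unit-on : ∀ d e → unit d e e ≡ sgn d
  unit-on d e with e ≟ e
  ... | yes _  = refl
  ... | no e≢e = ⊥-elim (e≢e refl)

  unit-off : ∀ d {e e′} → e ≢ e′ → unit d e e′ ≡ 0ℤ
  unit-off d {e} {e′} e≢e′ with e ≟ e′
  ... | yes e≡e′ = ⊥-elim (e≢e′ e≡e′)
  ... | no _     = refl

  unit-carries : ∀ d e → Carries (unit d e) 1ℤ (tl d e) (hd d e)
  unit-carries d e p = begin
    flux (unit d e) p
      ≡⟨ sum-only _ e (λ j j≢e → trans (cong (_* Δ p j) (unit-off d (j≢e ∘ sym)))
                                       (ℤ.*-zeroˡ (Δ p j))) ⟩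
    unit d e e * Δ p e
      ≡⟨ cong₂ _*_ (unit-on d e) (Δ-dart p d e) ⟩
    sgn d * (sgn d * (p (hd d e) - p (tl d e)))
      ≡⟨ ℤ.*-assoc (sgn d) (sgn d) _ ⟨
    sgn d * sgn d * (p (hd d e) - p (tl d e))
      ≡⟨ cong (_* (p (hd d e) - p (tl d e))) (sgn*sgn d) ⟩
    1ℤ * (p (hd d e) - p (tl d e)) ∎
    where open ≡-Reasoning

  carries-++ : ∀ f g {x y z} → Carries f 1ℤ x y → Carries g 1ℤ y z →
               Carries (combine 1ℤ f 1ℤ g) 1ℤ x z
  carries-++ f g {x} {y} {z} cf cg p =
    trans (flux-combine 1ℤ f 1ℤ g p)
      (trans (cong₂ (λ a b → 1ℤ * a + 1ℤ * b) (cf p) (cg p))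
        (telescope (p x) (p y) (p z)))
    where
    telescope : ∀ a b c → 1ℤ * (1ℤ * (b - a)) + 1ℤ * (1ℤ * (c - b)) ≡ 1ℤ * (c - a)
    telescope = solve-∀

  -- Both boundaries are multiples of y minus x, so subtracting the right multiple cancels them.
  -- With `k` = 1 this closes two paths with common ends into a circulation.
  carries-close : ∀ k f g {x y} → Carries f k x y → Carries g 1ℤ x y →
                  Circulation (combine 1ℤ f (- k) g)
  carries-close k f g {x} {y} cf cg p =
    trans (flux-combine 1ℤ f (- k) g p)
      (trans (cong₂ (λ a b → 1ℤ * a + (- k) * b) (cf p) (cg p))
        (cancel k (p y - p x)))
    where
    cancel : ∀ k a → 1ℤ * (k * a) + (- k) * (1ℤ * a) ≡ 0ℤ
    cancel = solve-∀

-- Cuts, and reachability along darts.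

ind : ∀ {n} → Subset n → Fin n → ℤ
ind R v = if does (v ∈? R) then 1ℤ else 0ℤ

ind-∈ : ∀ {n} {R : Subset n} {v} → v ∈ R → ind R v ≡ 1ℤ
ind-∈ {R = R} {v} v∈R with v ∈? R
... | yes _  = refl
... | no v∉R = ⊥-elim (v∉R v∈R)

ind-∉ : ∀ {n} {R : Subset n} {v} → v ∉ R → ind R v ≡ 0ℤ
ind-∉ {R = R} {v} v∉R with v ∈? R
... | yes v∈R = ⊥-elim (v∉R v∈R)
... | no _    = refl

⊂-∪⁅⁆ : ∀ {n} {R : Subset n} {v} → v ∉ R → R ⊂ R ∪ ⁅ v ⁆
⊂-∪⁅⁆ {R = R} {v} v∉R =
  p⊆p∪q ⁅ v ⁆ , v , q⊆p∪q R ⁅ v ⁆ (x∈⁅x⁆ v) , v∉R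

module Darts (G : Graph) where
  open Flux G

  anyDart? : {P : Bool → Edge G → Set} → (∀ d e → Dec (P d e)) →
             Dec (∃[ d ] ∃[ e ] P d e)
  anyDart? P? with any? (P? true) | any? (P? false)
  ... | yes p | _     = yes (true , p)
  ... | no _  | yes p = yes (false , p)
  ... | no ¬t | no ¬f = no λ { (true , p) → ¬t p ; (false , p) → ¬f p }

  Within : Subset (order G) → Edge G → Set
  Within R e = src e ∈ R × tgt e ∈ R

  within : ∀ {R} d e → tl d e ∈ R → hd d e ∈ R → Within R e
  within true  e t∈R h∈R = t∈R , h∈R
  within false e t∈R h∈R = h∈R , t∈R

  within-tl : ∀ {R} d e → Within R e → tl d e ∈ R
  within-tl true  e (s∈R , t∈R) = s∈R
  within-tl false e (s∈R , t∈R) = t∈R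

  within-hd : ∀ {R} d e → Within R e → hd d e ∈ R
  within-hd true  e (s∈R , t∈R) = t∈R
  within-hd false e (s∈R , t∈R) = s∈R

  within-mono : ∀ {R R′ e} → R ⊆ R′ → Within R e → Within R′ e
  within-mono R⊆R′ (s∈R , t∈R) = R⊆R′ s∈R , R⊆R′ t∈R

  Leaves : Subset (order G) → Bool → Edge G → Set
  Leaves R d e = tl d e ∈ R × hd d e ∉ R

  leaves? : ∀ R d e → Dec (Leaves R d e)
  leaves? R d e = (tl d e ∈? R) ×-dec ¬? (hd d e ∈? R)

  leaves-unique : ∀ {R d d′ e} → Leaves R d e → Leaves R d′ e → d ≡ d′
  leaves-unique {d = true}  {true}  _ _ = refl
  leaves-unique {d = false} {false} _ _ = refl
  leaves-unique {d = true}  {false} (t∈R , _) (_ , h∉R) = ⊥-elim (h∉R t∈R)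
  leaves-unique {d = false} {true}  (t∈R , _) (_ , h∉R) = ⊥-elim (h∉R t∈R)

  -- The indicator drops from 1 to 0 along a leaving dart. Pairing a chain with `ind R` therefore
  -- measures its net flow into `R`.
  Δ-leaves : ∀ {R} d e → Leaves R d e → Δ (ind R) e ≡ - sgn d
  Δ-leaves {R} d e (t∈R , h∉R) = begin
    Δ (ind R) e                                    ≡⟨ Δ-dart (ind R) d e ⟩
    sgn d * (ind R (hd d e) - ind R (tl d e))
      ≡⟨ cong₂ (λ a b → sgn d * (a - b)) (ind-∉ h∉R) (ind-∈ t∈R) ⟩
    sgn d * ℤ.-1ℤ                                  ≡⟨ ℤ.*-comm (sgn d) ℤ.-1ℤ ⟩
    ℤ.-1ℤ * sgn d                                  ≡⟨ ℤ.-1*i≡-i (sgn d) ⟩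
    - sgn d                                        ∎
    where open ≡-Reasoning

  side : ∀ R e → (ind R (src e) ≡ ind R (tgt e)) ⊎ (∃[ d ] Leaves R d e)
  side R e with src e ∈? R | tgt e ∈? R
  ... | yes s∈R | yes t∈R = inj₁ refl
  ... | no s∉R  | no t∉R  = inj₁ refl
  ... | yes s∈R | no t∉R  = inj₂ (true , s∈R , t∉R)
  ... | no s∉R  | yes t∈R = inj₂ (false , t∈R , s∉R)

  Δ-same : ∀ {R e} → ind R (src e) ≡ ind R (tgt e) → Δ (ind R) e ≡ 0ℤ
  Δ-same {R} {e} eq =
    trans (cong (λ a → ind R (tgt e) - a) eq) (ℤ.+-inverseʳ (ind R (tgt e)))

  -- Growing the set one new vertex at a time makes the walk to each vertex
  -- edge-simple, so that it carries a flow with values 0, ±1.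
  module Search {A : Bool → Edge G → Set} (A? : ∀ d e → Dec (A d e))
                (x : Vertex G) where

    data Reached : Subset (order G) → Set where
      start  : Reached ⁅ x ⁆
      extend : ∀ {R} d e → Reached R → A d e → Leaves R d e →
               Reached (R ∪ ⁅ hd d e ⁆)

    Closed : Subset (order G) → Set
    Closed R = ∀ d e → A d e → tl d e ∈ R → hd d e ∈ R

    search : ∃[ R ] (Reached R × Closed R)
    search = grow start (⊃-wellFounded ⁅ x ⁆)
      where
      grow : ∀ {R} → Reached R → Acc _⊃_ R → ∃[ R′ ] (Reached R′ × Closed R′)
      grow {R} r (acc rec) with anyDart? (λ d e → A? d e ×-dec leaves? R d e)
      ... | yes (d , e , a , out) =
        grow (extend d e r a out) (rec (⊂-∪⁅⁆ (proj₂ out)))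
      ... | no stuck = R , r , closed
        where
        closed : Closed R
        closed d e a t∈R with hd d e ∈? R
        ... | yes h∈R = h∈R
        ... | no h∉R  = ⊥-elim (stuck (d , e , a , t∈R , h∉R))

    root∈ : ∀ {R} → Reached R → x ∈ R
    root∈ start            = x∈⁅x⁆ x
    root∈ (extend _ _ r _ _) = p⊆p∪q _ (root∈ r)

    reached-⊆ : ∀ {R X} → x ∈ X → (∀ d e → A d e → hd d e ∈ X) →
                Reached R → R ⊆ X
    reached-⊆ x∈X A⇒X start v∈R with refl ← x∈⁅y⁆⇒x≡y x v∈R = x∈X
    reached-⊆ x∈X A⇒X (extend {R} d e r a _) v∈R
      with x∈p∪q⁻ R ⁅ hd d e ⁆ v∈R
    ... | inj₁ v∈ = reached-⊆ x∈X A⇒X r v∈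
    ... | inj₂ v∈ with refl ← x∈⁅y⁆⇒x≡y (hd d e) v∈ = A⇒X d e a

    Step : Vertex G → Vertex G → Set
    Step u v = ∃[ d ] ∃[ e ] (A d e × direct d (ends G e) ≡ (u , v))

    reached-walk : ∀ {R w} → Reached R → w ∈ R → Star Step x w
    reached-walk start w∈R with refl ← x∈⁅y⁆⇒x≡y x w∈R = ε
    reached-walk (extend {R} d e r a (t∈R , _)) w∈R
      with x∈p∪q⁻ R ⁅ hd d e ⁆ w∈R
    ... | inj₁ w∈ = reached-walk r w∈
    ... | inj₂ w∈ with refl ← x∈⁅y⁆⇒x≡y (hd d e) w∈ =
      reached-walk r t∈R ◅◅ (d , e , a , refl) ◅ ε

    walk-closed : ∀ {R u w} → Closed R → u ∈ R → Star Step u w → w ∈ R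
    walk-closed closed u∈R ε = u∈R
    walk-closed closed u∈R ((d , e , a , refl) ◅ walk) =
      walk-closed closed (closed d e a u∈R) walk

    -- Keeping the support within `R` ensures that a dart leaving `R` uses a fresh edge; this
    -- invariant is what keeps the values at 0, ±1 in `reached-flow`.
    Along : Subset (order G) → Chain → Edge G → Set
    Along R q e = q e ≡ 0ℤ ⊎ ((∃[ d ] (A d e × q e ≡ sgn d)) × Within R e)

    reached-flow : ∀ {R w} → Reached R → w ∈ R →
                   ∃[ q ] (Carries q 1ℤ x w × (∀ e → Along R q e))
    reached-flow start w∈R with refl ← x∈⁅y⁆⇒x≡y x w∈R =
      (λ _ → 0ℤ) , carries-zero , λ _ → inj₁ refl
    reached-flow (extend {R} d e r a (t∈R , h∉R)) w∈R
      with x∈p∪q⁻ R ⁅ hd d e ⁆ w∈R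
    ... | inj₁ w∈ = weaken (reached-flow r w∈)
      where
      weaken : ∃[ q ] (Carries q 1ℤ x _ × (∀ e → Along R q e)) →
               ∃[ q ] (Carries q 1ℤ x _ × (∀ e′ → Along (R ∪ ⁅ hd d e ⁆) q e′))
      weaken (q , carr , along) = q , carr , along′
        where
        along′ : ∀ e′ → Along (R ∪ ⁅ hd d e ⁆) q e′
        along′ e′ with along e′
        ... | inj₁ z        = inj₁ z
        ... | inj₂ (s , in-R) = inj₂ (s , within-mono (p⊆p∪q _) in-R)
    ... | inj₂ w∈ with refl ← x∈⁅y⁆⇒x≡y (hd d e) w∈ =
      append (reached-flow r t∈R)
      where
      append : ∃[ q ] (Carries q 1ℤ x (tl d e) × (∀ e → Along R q e)) →
               ∃[ q ] (Carries q 1ℤ x (hd d e) ×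
                       (∀ e′ → Along (R ∪ ⁅ hd d e ⁆) q e′))
      append (q , carr , along) =
        combine 1ℤ q 1ℤ (unit d e) , carries-++ q (unit d e) carr (unit-carries d e) , along′
        where
        along′ : ∀ e′ → Along (R ∪ ⁅ hd d e ⁆) (combine 1ℤ q 1ℤ (unit d e)) e′
        along′ e′ with e ≟ e′
        along′ e′ | yes refl with along e
        ... | inj₁ z        =
          inj₂ ((d , a , 1·0+1b {b = sgn d} z) ,
                within d e (p⊆p∪q _ t∈R) (q⊆p∪q R _ (x∈⁅x⁆ (hd d e))))
        ... | inj₂ (_ , in-R) = ⊥-elim (h∉R (within-hd d e in-R))
        along′ e′ | no e≢e′ with along e′
        ... | inj₁ z        = inj₁ (trans (1a+1·0 {b = 0ℤ} refl) z)
        ... | inj₂ ((d′ , a′ , z) , in-R) =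
          inj₂ ((d′ , a′ , trans (1a+1·0 {b = 0ℤ} refl) z) , within-mono (p⊆p∪q _) in-R)

-- Counting, and pushing a value towards zero.

sumℕ-≤ : ∀ {n} {a b : Fin n → ℕ} → (∀ i → a i ≤ b i) → sumℕ a ≤ sumℕ b
sumℕ-≤ {zero}  a≤b = z≤n
sumℕ-≤ {suc n} a≤b = ℕ.+-mono-≤ (a≤b zero) (sumℕ-≤ (a≤b ∘ suc))

sumℕ-< : ∀ {n} {a b : Fin n → ℕ} → (∀ i → a i ≤ b i) →
         ∀ i → a i < b i → sumℕ a < sumℕ b
sumℕ-< a≤b zero    a<b = ℕ.+-mono-<-≤ a<b (sumℕ-≤ (a≤b ∘ suc))
sumℕ-< a≤b (suc i) a<b = ℕ.+-mono-≤-< (a≤b zero) (sumℕ-< (a≤b ∘ suc) i a<b)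

∣p∪q∣≤∣p∣+∣q∣ : ∀ {n} (p q : Subset n) → ∣ p ∪ q ∣ ≤ ∣ p ∣ ℕ.+ ∣ q ∣
∣p∪q∣≤∣p∣+∣q∣ []          []          = z≤n
∣p∪q∣≤∣p∣+∣q∣ (true ∷ p)  (true ∷ q)  =
  s≤s (ℕ.≤-trans (∣p∪q∣≤∣p∣+∣q∣ p q) (ℕ.+-monoʳ-≤ ∣ p ∣ (ℕ.n≤1+n ∣ q ∣)))
∣p∪q∣≤∣p∣+∣q∣ (true ∷ p)  (false ∷ q) = s≤s (∣p∪q∣≤∣p∣+∣q∣ p q)
∣p∪q∣≤∣p∣+∣q∣ (false ∷ p) (true ∷ q)  =
  subst (suc ∣ p ∪ q ∣ ≤_) (sym (ℕ.+-suc ∣ p ∣ ∣ q ∣)) (s≤s (∣p∪q∣≤∣p∣+∣q∣ p q))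
∣p∪q∣≤∣p∣+∣q∣ (false ∷ p) (false ∷ q) = ∣p∪q∣≤∣p∣+∣q∣ p q

∣p∪⁅x⁆∣≤1+∣p∣ : ∀ {n} (p : Subset n) x → ∣ p ∪ ⁅ x ⁆ ∣ ≤ suc ∣ p ∣
∣p∪⁅x⁆∣≤1+∣p∣ p x = begin
  ∣ p ∪ ⁅ x ⁆ ∣        ≤⟨ ∣p∪q∣≤∣p∣+∣q∣ p ⁅ x ⁆ ⟩
  ∣ p ∣ ℕ.+ ∣ ⁅ x ⁆ ∣  ≡⟨ cong (∣ p ∣ ℕ.+_) (∣⁅x⁆∣≡1 x) ⟩
  ∣ p ∣ ℕ.+ 1          ≡⟨ ℕ.+-comm ∣ p ∣ 1 ⟩
  suc ∣ p ∣            ∎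
  where open ℕ.≤-Reasoning

positive : ∀ a → a ≢ 0ℤ → ∃[ d ] 0ℤ ℤ.< sgn d * a
positive (+ zero)  a≢0 = ⊥-elim (a≢0 refl)
positive (+ suc n) _   = true , ℤ.+<+ (s≤s z≤n)
positive -[1+ n ]  _   = false , ℤ.+<+ (s≤s z≤n)

positive-unique : ∀ d a → 0ℤ ℤ.< sgn d * a → does (0ℤ ℤ.<? a) ≡ d
positive-unique true  (+ zero)  (ℤ.+<+ ())
positive-unique true  (+ suc n) _ = refl
positive-unique true  -[1+ n ]  ()
positive-unique false (+ zero)  (ℤ.+<+ ())
positive-unique false (+ suc n) ()
positive-unique false -[1+ n ]  _ = refl

∣a∣≡1⇒a≡sgn : ∀ a → ℤ.∣ a ∣ ≡ 1 → ∃[ d ] a ≡ sgn d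
∣a∣≡1⇒a≡sgn (+ 1)    refl = true , refl
∣a∣≡1⇒a≡sgn -[1+ 0 ] refl = false , refl

a*-b≡-[b*a] : ∀ a b → a * (- b) ≡ - (b * a)
a*-b≡-[b*a] = solve-∀

≮⇒0≤neg : ∀ {a} → ¬ 0ℤ ℤ.< a → 0ℤ ℤ.≤ - a
≮⇒0≤neg {a} a≯0 = ℤ.neg-mono-≤ (ℤ.≮⇒≥ a≯0)

-- The push changes |a| to ||a| − k|, so values of size at most j stay so.
excess-push : ∀ k j → k ≡ + suc j → ∀ d a → 0ℤ ℤ.< sgn d * a →
  let a′ = 1ℤ * a + (- k) * sgn d in
  ℤ.∣ a′ ∣ ∸ j ≤ ℤ.∣ a ∣ ∸ j × (j < ℤ.∣ a ∣ → ℤ.∣ a′ ∣ ∸ j < ℤ.∣ a ∣ ∸ j)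
excess-push k j k≡ d a d*a>0 with sgn d * a in eq
... | -[1+ m ] = ⊥-elim (ℤ.<-asym d*a>0 ℤ.-<+)
... | + zero   = ⊥-elim (ℤ.<-irrefl refl d*a>0)
... | + suc m  = subst₂ (λ b b′ → b′ ∸ j ≤ b ∸ j × (j < b → b′ ∸ j < b ∸ j))
                   (sym abs-a) (sym abs-a′) bounds
  where
  ∣sgn∣ : ∀ d → ℤ.∣ sgn d ∣ ≡ 1
  ∣sgn∣ true  = refl
  ∣sgn∣ false = refl

  abs-sgn* : ∀ b → ℤ.∣ sgn d * b ∣ ≡ ℤ.∣ b ∣
  abs-sgn* b = trans (ℤ.abs-* (sgn d) b)
    (trans (cong (ℕ._* ℤ.∣ b ∣) (∣sgn∣ d)) (ℕ.*-identityˡ ℤ.∣ b ∣))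

  abs-a : ℤ.∣ a ∣ ≡ suc m
  abs-a = trans (sym (abs-sgn* a)) (cong ℤ.∣_∣ eq)

  distribute : ∀ s a k → s * (1ℤ * a + (- k) * s) ≡ s * a - k * (s * s)
  distribute = solve-∀

  abs-a′ : ℤ.∣ 1ℤ * a + (- k) * sgn d ∣ ≡ ℤ.∣ m ℤ.⊖ j ∣
  abs-a′ = begin
    ℤ.∣ 1ℤ * a + (- k) * sgn d ∣
      ≡⟨ abs-sgn* _ ⟨
    ℤ.∣ sgn d * (1ℤ * a + (- k) * sgn d) ∣
      ≡⟨ cong ℤ.∣_∣ (distribute (sgn d) a k) ⟩
    ℤ.∣ sgn d * a - k * (sgn d * sgn d) ∣
      ≡⟨ cong₂ (λ b c → ℤ.∣ b - k * c ∣) eq (sgn*sgn d) ⟩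
    ℤ.∣ + suc m - k * 1ℤ ∣
      ≡⟨ cong (λ b → ℤ.∣ + suc m - b ∣) (trans (ℤ.*-identityʳ k) k≡) ⟩
    ℤ.∣ suc m ℤ.⊖ suc j ∣
      ≡⟨ cong ℤ.∣_∣ (ℤ.[1+m]⊖[1+n]≡m⊖n m j) ⟩
    ℤ.∣ m ℤ.⊖ j ∣ ∎
    where open ≡-Reasoning

  m∸j<1+m∸j : j ≤ m → m ∸ j < suc m ∸ j
  m∸j<1+m∸j j≤m = ℕ.≤-reflexive (sym (ℕ.+-∸-assoc 1 j≤m))

  bounds : ℤ.∣ m ℤ.⊖ j ∣ ∸ j ≤ suc m ∸ j ×
           (j < suc m → ℤ.∣ m ℤ.⊖ j ∣ ∸ j < suc m ∸ j)
  bounds with ℕ.≤-total j m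
  ... | inj₁ j≤m rewrite trans (ℤ.∣m⊖n∣≡∣n⊖m∣ m j) (ℤ.∣⊖∣-≤ j≤m) =
    ℕ.<⇒≤ strict , λ _ → strict
    where
    strict : m ∸ j ∸ j < suc m ∸ j
    strict = ℕ.≤-<-trans (ℕ.m∸n≤m (m ∸ j) j) (m∸j<1+m∸j j≤m)
  -- Here the new absolute value is `j ∸ m`, at most `j`, so no excess remains.
  ... | inj₂ m≤j rewrite ℤ.∣⊖∣-≤ m≤j | ℕ.m≤n⇒m∸n≡0 (ℕ.m∸n≤m j m) =
    z≤n , λ j<1+m → ℕ.m<n⇒0<n∸m j<1+m

-- Directed cycles, reduction modulo an integer, and deletable edges.

module Positive (G : Graph) where
  open Flux G
  open Darts G

  carries-loop : ∀ {f k x} → Carries f k x x → Circulation f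
  carries-loop {f} {k} {x} carr p =
    trans (carr p) (trans (cong (k *_) (ℤ.+-inverseʳ (p x))) (ℤ.*-zeroʳ k))

  module Forward (f : Chain) (e₀ : Edge G) where

    -- The edge `e₀` is excluded for two purposes: closing a directed cycle through `e₀` by a path
    -- that avoids it, and reaching all vertices after `e₀` is deleted.
    Forward : Bool → Edge G → Set
    Forward d e = e ≢ e₀ × 0ℤ ℤ.< sgn d * f e

    forward? : ∀ d e → Dec (Forward d e)
    forward? d e = ¬? (e ≟ e₀) ×-dec (0ℤ ℤ.<? sgn d * f e)

    module From (x : Vertex G) = Search forward? x

    cross : Subset (order G) → Chain
    cross R e = f e * Δ (ind R) e

    cross-same : ∀ {R e} → ind R (src e) ≡ ind R (tgt e) → cross R e ≡ 0ℤ
    cross-same {R} {e} eq = trans (cong (f e *_) (Δ-same {R} {e} eq)) (ℤ.*-zeroʳ (f e))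

    cross-leaves : ∀ {R} d e → Leaves R d e → cross R e ≡ - (sgn d * f e)
    cross-leaves {R} d e out =
      trans (cong (f e *_) (Δ-leaves d e out)) (a*-b≡-[b*a] (f e) (sgn d))

    -- As `R` is closed, a dart leaving `R` with positive flow could only be on `e₀`; every other
    -- edge across the cut can only bring flow into `R`.
    cross≥0 : ∀ {R} → (∀ d e → Forward d e → tl d e ∈ R → hd d e ∈ R) →
              ∀ e → e ≢ e₀ → 0ℤ ℤ.≤ cross R e
    cross≥0 {R = R} closed e e≢e₀ with side R e
    ... | inj₁ same = ℤ.≤-reflexive (sym (cross-same {R} {e} same))
    ... | inj₂ (d , out@(t∈R , h∉R)) =
      subst (0ℤ ℤ.≤_) (sym (cross-leaves {R} d e out))
        (≮⇒0≤neg (λ pos → h∉R (closed d e (e≢e₀ , pos) t∈R)))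

  Conforms : Chain → Chain → Edge G → Set
  Conforms f c e = c e ≡ 0ℤ ⊎ (∃[ d ] (0ℤ ℤ.< sgn d * f e × c e ≡ sgn d))

  -- Search from the head of the given dart. If its tail were not reached, `e₀` would bring positive
  -- flow into `R` while no other edge takes any out, against conservation. The path to the tail and
  -- the dart itself form the cycle.
  directed-cycle : ∀ f → Circulation f → ∀ d₀ e₀ → 0ℤ ℤ.< sgn d₀ * f e₀ →
    ∃[ c ] (Circulation c × c e₀ ≡ sgn d₀ × (∀ e → Conforms f c e))
  directed-cycle f f-circ d₀ e₀ pos = c , c-circ , c-e₀ , conforms
    where
    open Forward f e₀
    open From (hd d₀ e₀)

    R        = proj₁ search
    reached  = proj₁ (proj₂ search)
    closed   = proj₂ (proj₂ search)

    t∈R : tl d₀ e₀ ∈ R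
    t∈R with tl d₀ e₀ ∈? R
    ... | yes t∈R = t∈R
    ... | no t∉R = ⊥-elim (ℤ.<-irrefl refl (ℤ.<-≤-trans enters
                     (subst (cross R e₀ ℤ.≤_) (f-circ (ind R)) (term≤sum (cross R) all≥0 e₀))))
      where
      enters : 0ℤ ℤ.< cross R e₀
      enters = subst (0ℤ ℤ.<_) (sym (trans (cong (f e₀ *_) (Δ-dart (ind R) d₀ e₀))
        (trans (cong₂ (λ a b → f e₀ * (sgn d₀ * (a - b)))
                 (ind-∈ (root∈ reached)) (ind-∉ t∉R))
          (tidy (f e₀) (sgn d₀))))) pos
        where
        tidy : ∀ a s → a * (s * (1ℤ - 0ℤ)) ≡ s * a
        tidy = solve-∀
      all≥0 : ∀ e → 0ℤ ℤ.≤ cross R e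
      all≥0 e with e ≟ e₀
      ... | yes refl = ℤ.<⇒≤ enters
      ... | no e≢e₀  = cross≥0 closed e e≢e₀

    flow  = reached-flow reached t∈R
    q     = proj₁ flow
    along = proj₂ (proj₂ flow)

    c : Chain
    c = combine 1ℤ q 1ℤ (unit d₀ e₀)

    c-circ : Circulation c
    c-circ = carries-loop {c} {1ℤ} {hd d₀ e₀}
      (carries-++ q (unit d₀ e₀) (proj₁ (proj₂ flow)) (unit-carries d₀ e₀))

    c-e₀ : c e₀ ≡ sgn d₀
    c-e₀ with along e₀
    ... | inj₁ q≡0 = trans (cong₂ (λ a b → 1ℤ * a + 1ℤ * b) q≡0 (unit-on d₀ e₀))
                       (1·0+1b {a = 0ℤ} refl)
    ... | inj₂ ((_ , (e≢e , _) , _) , _) = ⊥-elim (e≢e refl)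

    conforms : ∀ e → Conforms f c e
    conforms e with e ≟ e₀
    ... | yes refl = inj₂ (d₀ , pos , c-e₀)
    ... | no e≢e₀ = off (along e)
      where
      c≡q : c e ≡ q e
      c≡q = trans (cong (λ b → 1ℤ * q e + 1ℤ * b) (unit-off d₀ (e≢e₀ ∘ sym)))
              (trans (ℤ.+-identityʳ _) (ℤ.*-identityˡ _))
      off : _ → Conforms f c e
      off (inj₁ q≡0)                      = inj₁ (trans c≡q q≡0)
      off (inj₂ ((d , (_ , pos) , q≡) , _)) = inj₂ (d , pos , trans c≡q q≡)

  -- Reduction modulo j + 1, as in Tutte's proof that a flow over ℤ/k lifts to
  -- an integer flow with values smaller than k.
  Reduced : ℤ → ℕ → Chain → Set
  Reduced k j f = ∃[ z ] (Circulation z × (∀ e → ℤ.∣ f e - k * z e ∣ ≤ j))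

  -- While some absolute value exceeds `j`, subtract `k` times a directed cycle through that edge.
  -- By `excess-push` no edge gains excess over `j` and the chosen edge loses some, so the total
  -- excess decreases; `z` collects the cycles.
  reduce : ∀ k j → k ≡ + suc j → ∀ f → Circulation f → Reduced k j f
  reduce k j k≡ f f-circ = go f f-circ (<-wellFounded (excess f))
    where
    excess : Chain → ℕ
    excess f = sumℕ (λ e → ℤ.∣ f e ∣ ∸ j)

    go : ∀ f → Circulation f → Acc _<_ (excess f) → Reduced k j f
    go f f-circ (acc rec) with any? (λ e → j ℕ.<? ℤ.∣ f e ∣)
    ... | no small = (λ _ → 0ℤ) , circulation-zero , λ e →
      subst (λ a → ℤ.∣ a ∣ ≤ j) (sym (minus-zero (f e) (k)))
        (ℕ.≮⇒≥ (λ big → small (e , big)))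
      where
      minus-zero : ∀ a k → a - k * 0ℤ ≡ a
      minus-zero = solve-∀
    ... | yes (e₀ , big) = step (positive (f e₀) nonzero)
      where
      nonzero : f e₀ ≢ 0ℤ
      nonzero f≡0 with subst (λ a → j < ℤ.∣ a ∣) f≡0 big
      ... | ()

      step : ∃[ d ] 0ℤ ℤ.< sgn d * f e₀ → Reduced k j f
      step (d₀ , pos) = push (directed-cycle f f-circ d₀ e₀ pos)
        where
        push : ∃[ c ] (Circulation c × c e₀ ≡ sgn d₀ × (∀ e → Conforms f c e)) → Reduced k j f
        push (c , c-circ , c-e₀ , conforms) = finish (go f′ f′-circ (rec decreasing))
          where
          f′ : Chain
          f′ = combine 1ℤ f (- k) c

          f′-circ : Circulation f′
          f′-circ = circulation-combine 1ℤ f (- k) c f-circ c-circ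

          no-more : ∀ e → ℤ.∣ f′ e ∣ ∸ j ≤ ℤ.∣ f e ∣ ∸ j
          no-more e with conforms e
          ... | inj₁ c≡0 = ℕ.≤-reflexive (cong (λ a → ℤ.∣ a ∣ ∸ j)
                  (trans (cong (λ b → 1ℤ * f e + (- k) * b) c≡0)
                    (unchanged (f e) (- k))))
            where
            unchanged : ∀ a k → 1ℤ * a + k * 0ℤ ≡ a
            unchanged = solve-∀
          ... | inj₂ (d , pos , c≡) =
            subst (λ b → ℤ.∣ 1ℤ * f e + (- k) * b ∣ ∸ j ≤ ℤ.∣ f e ∣ ∸ j) (sym c≡)
              (proj₁ (excess-push k j k≡ d (f e) pos))

          decreasing : excess f′ < excess f
          decreasing = sumℕ-< no-more e₀
            (subst (λ b → ℤ.∣ 1ℤ * f e₀ + (- k) * b ∣ ∸ j < ℤ.∣ f e₀ ∣ ∸ j) (sym c-e₀)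
              (proj₂ (excess-push k j k≡ d₀ (f e₀) pos) big))

          finish : Reduced k j f′ → Reduced k j f
          finish (z , z-circ , bound) =
            combine 1ℤ z 1ℤ c , circulation-combine 1ℤ z 1ℤ c z-circ c-circ ,
            λ e → subst (λ a → ℤ.∣ a ∣ ≤ j) (regroup (f e) (k) (c e) (z e)) (bound e)
            where
            regroup : ∀ a k c z → 1ℤ * a + (- k) * c - k * z ≡ a - k * (1ℤ * z + 1ℤ * c)
            regroup = solve-∀

  module Cut (conn : EdgeConnected 3 G) where

    -- A walk from `u` to `v` that avoids `F` has a first step out of `U`. Repeating this with the
    -- edges found so far put into `F` yields distinct edges of the cut.
    crossing : ∀ {U u v} (F : EdgeSet G) → ∣ F ∣ < 3 → u ∈ U → v ∉ U →
               ∃[ d ] ∃[ e ] (e ∉ F × Leaves U d e)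
    crossing {U} {u} {v} F ∣F∣<3 u∈U v∉U = first u∈U (conn F ∣F∣<3 u v)
      where
      first : ∀ {w} → w ∈ U → Star (Adjacent G (∁ F)) w v →
              ∃[ d ] ∃[ e ] (e ∉ F × Leaves U d e)
      first w∈U ε = ⊥-elim (v∉U w∈U)
      first w∈U (_◅_ {j = w′} (e , e∈∁F , joins) walk) with w′ ∈? U
      ... | yes w′∈U = first w′∈U walk
      ... | no w′∉U with joins
      ...   | inj₁ eq = true , e , x∈∁p⇒x∉p e∈∁F ,
                subst (λ a → proj₁ a ∈ U × proj₂ a ∉ U) (sym eq) (w∈U , w′∉U)
      ...   | inj₂ eq = false , e , x∈∁p⇒x∉p e∈∁F ,
                subst (λ a → proj₂ a ∈ U × proj₁ a ∉ U) (sym eq) (w∈U , w′∉U)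

    orient : Chain → Orientation G
    orient f = tabulate (λ e → does (0ℤ ℤ.<? f e))

    -- Let `R` be the set reached from `u` without `e₀`. If it missed `v`, at least two edges other
    -- than `e₀` would cross the cut, each bringing at least 1 into `R`, whereas `e₀` can take out
    -- only 1.
    deletable : ∀ f → Circulation f → (∀ e → f e ≢ 0ℤ) →
                ∀ e₀ → ℤ.∣ f e₀ ∣ ≡ 1 → Deletable G (orient f) e₀
    deletable f f-circ f≢0 e₀ ∣f∣≡1 u v _ = walk (v ∈? R)
      where
      open Forward f e₀
      open From u

      R        = proj₁ search
      reached  = proj₁ (proj₂ search)
      closed   = proj₂ (proj₂ search)

      -- Adding 1 at `e₀` offsets the most that `e₀` can take out of `R`. All terms become
      -- nonnegative, and their sum is 1 by conservation.
      c : Chain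
      c e = cross R e + unit true e₀ e

      sum-c : sum c ≡ 1ℤ
      sum-c = trans (∑-distrib-+ (cross R) (unit true e₀))
        (cong₂ _+_ (f-circ (ind R))
          (trans (sum-only (unit true e₀) e₀ (λ j j≢ → unit-off true (j≢ ∘ sym)))
            (unit-on true e₀)))

      c-e₀≥0 : 0ℤ ℤ.≤ c e₀
      c-e₀≥0 = subst (λ b → 0ℤ ℤ.≤ cross R e₀ + b) (sym (unit-on true e₀)) at-least
        where
        by-sign : ∀ d d′ → 0ℤ ℤ.≤ - (sgn d * sgn d′) + 1ℤ
        by-sign true  true  = ℤ.+≤+ z≤n
        by-sign true  false = ℤ.+≤+ z≤n
        by-sign false true  = ℤ.+≤+ z≤n
        by-sign false false = ℤ.+≤+ z≤n
        at-least : 0ℤ ℤ.≤ cross R e₀ + 1ℤ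
        at-least with side R e₀
        ... | inj₁ same rewrite cross-same {R} {e₀} same = ℤ.+≤+ z≤n
        ... | inj₂ (d , out) with ∣a∣≡1⇒a≡sgn (f e₀) ∣f∣≡1
        ...   | d′ , f≡ = subst (λ a → 0ℤ ℤ.≤ a + 1ℤ)
                (sym (trans (cross-leaves {R} d e₀ out) (cong (λ a → - (sgn d * a)) f≡)))
                (by-sign d d′)

      c≡cross : ∀ {e} → e ≢ e₀ → c e ≡ cross R e
      c≡cross {e} e≢e₀ = trans (cong (λ b → cross R e + b) (unit-off true (e≢e₀ ∘ sym)))
                       (ℤ.+-identityʳ (cross R e))

      c≥0 : ∀ e → 0ℤ ℤ.≤ c e
      c≥0 e with e ≟ e₀
      ... | yes refl = c-e₀≥0
      ... | no e≢e₀  = subst (0ℤ ℤ.≤_) (sym (c≡cross e≢e₀)) (cross≥0 closed e e≢e₀)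

      neg-zero : ∀ {a} → - a ≡ 0ℤ → a ≡ 0ℤ
      neg-zero {a} eq = trans (sym (ℤ.neg-involutive a)) (cong -_ eq)

      sgn-cancel : ∀ d {a} → sgn d * a ≡ 0ℤ → a ≡ 0ℤ
      sgn-cancel true  {a} eq = trans (sym (ℤ.*-identityˡ a)) eq
      sgn-cancel false {a} eq = neg-zero (trans (sym (ℤ.-1*i≡-i a)) eq)

      c≥1 : ∀ d e → e ≢ e₀ → Leaves R d e → 1ℤ ℤ.≤ c e
      c≥1 d e e≢e₀ out = ℤ.i<j⇒suc[i]≤j (ℤ.≤∧≢⇒< (c≥0 e) (λ 0≡c →
        f≢0 e (sgn-cancel d (neg-zero (trans (sym (cross-leaves {R} d e out))
          (trans (sym (c≡cross e≢e₀)) (sym 0≡c)))))))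

      cut : v ∉ R → ⊥
      cut v∉R = first (crossing ⁅ e₀ ⁆ (subst (_< 3) (sym (∣⁅x⁆∣≡1 e₀)) (s≤s (s≤s z≤n)))
                         (root∈ reached) v∉R)
        where
        clash : ∀ d₁ d₂ {e₁ e₂} → e₁ ∉ ⁅ e₀ ⁆ → Leaves R d₁ e₁ →
                e₂ ∉ ⁅ e₀ ⁆ ∪ ⁅ e₁ ⁆ → Leaves R d₂ e₂ → 1ℤ + 1ℤ ℤ.≤ 1ℤ
        clash d₁ d₂ {e₁} {e₂} e₁∉ out₁ e₂∉ out₂ =
          ℤ.≤-trans
            (ℤ.+-mono-≤ (c≥1 d₁ e₁ (λ { refl → e₁∉ (x∈⁅x⁆ e₁) }) out₁)
                        (c≥1 d₂ e₂ (λ { refl → e₂∉ (p⊆p∪q ⁅ e₁ ⁆ (x∈⁅x⁆ e₂)) }) out₂))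
            (subst (c e₁ + c e₂ ℤ.≤_) sum-c (pair≤sum c c≥0 e₁ e₂
              (λ { refl → e₂∉ (q⊆p∪q ⁅ e₀ ⁆ ⁅ e₂ ⁆ (x∈⁅x⁆ e₂)) })))

        absurd : 1ℤ + 1ℤ ℤ.≤ 1ℤ → ⊥
        absurd (ℤ.+≤+ (s≤s ()))

        first : ∃[ d ] ∃[ e ] (e ∉ ⁅ e₀ ⁆ × Leaves R d e) → ⊥
        first (d₁ , e₁ , e₁∉ , out₁) = second
          (crossing (⁅ e₀ ⁆ ∪ ⁅ e₁ ⁆)
            (s≤s (ℕ.≤-trans (∣p∪⁅x⁆∣≤1+∣p∣ ⁅ e₀ ⁆ e₁)
              (s≤s (ℕ.≤-reflexive (∣⁅x⁆∣≡1 e₀)))))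
            (root∈ reached) v∉R)
          where
          second : ∃[ d ] ∃[ e ] (e ∉ ⁅ e₀ ⁆ ∪ ⁅ e₁ ⁆ × Leaves R d e) → ⊥
          second (d₂ , e₂ , e₂∉ , out₂) = absurd (clash d₁ d₂ e₁∉ out₁ e₂∉ out₂)

      to-arc : ∀ {a b} → Step a b → Arc G (∁ ⁅ e₀ ⁆) (orient f) a b
      to-arc (d , e , (e≢e₀ , pos) , eq) =
        e , x∉p⇒x∈∁p (x≢y⇒x∉⁅y⁆ e≢e₀) ,
        trans (cong (λ b → direct b (ends G e))
                (trans (lookup∘tabulate _ e) (positive-unique d (f e) pos))) eq

      walk : Dec (v ∈ R) → Star (Arc G (∁ ⁅ e₀ ⁆) (orient f)) u v
      walk (yes v∈R) = map to-arc (reached-walk reached v∈R)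
      walk (no v∉R)  = ⊥-elim (cut v∉R)

-- Values 0, ±1, and residues modulo 3.

data Small : ℤ → Set where
  nil : Small 0ℤ
  one : ∀ d → Small (sgn d)

small : ∀ a → ℤ.∣ a ∣ ≤ 1 → Small a
small (+ 0)          _ = nil
small (+ 1)          _ = one true
small (+ suc (suc _)) (s≤s ())
small -[1+ 0 ]       _ = one false
small -[1+ suc _ ]   (s≤s ())

sgn≢0 : ∀ d → sgn d ≢ 0ℤ
sgn≢0 true  ()
sgn≢0 false ()

small-push : ∀ {a} d → Small a → a ≢ sgn d → Small (1ℤ * a + 1ℤ * sgn d)
small-push true  nil         _   = one true
small-push false nil         _   = one false
small-push true  (one true)  a≢s = ⊥-elim (a≢s refl)
small-push true  (one false) _   = nil
small-push false (one true)  _   = nil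
small-push false (one false) a≢s = ⊥-elim (a≢s refl)

-- For a dart `d` leaving a set, `- (sgn d * a)` is the flow brought into the set; it is negative
-- only if the flow follows the dart.
small-against : ∀ {a} d → Small a → a ≢ sgn d → 0ℤ ℤ.≤ - (sgn d * a)
small-against d     nil         _   = ℤ.≤-reflexive (cong -_ (sym (ℤ.*-zeroʳ (sgn d))))
small-against true  (one true)  a≢s = ⊥-elim (a≢s refl)
small-against true  (one false) _   = ℤ.+≤+ z≤n
small-against false (one true)  _   = ℤ.+≤+ z≤n
small-against false (one false) a≢s = ⊥-elim (a≢s refl)

small-against-0 : ∀ {a} d → Small a → a ≢ sgn d → - (sgn d * a) ℤ.≤ 0ℤ → a ≡ 0ℤ
small-against-0 d     nil         _   _ = refl
small-against-0 true  (one true)  a≢s _ = ⊥-elim (a≢s refl)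
small-against-0 true  (one false) _   (ℤ.+≤+ ())
small-against-0 false (one true)  _   (ℤ.+≤+ ())
small-against-0 false (one false) a≢s _ = ⊥-elim (a≢s refl)

sgn-not : ∀ d → sgn (not d) ≡ - sgn d
sgn-not true  = refl
sgn-not false = refl

-- The coefficient `k` fails at an edge where the chain to be corrected is `a` and the correcting
-- circulation is `sgn d`. The factor `1ℤ` matches the shape of `combine`.
Bad : ℤ → Bool → ℤ → Set
Bad a d k = + 3 Div.∣ 1ℤ * a + k * sgn d

bad-once : ∀ a d k k′ → ¬ (+ 3 Div.∣ (k - k′) * sgn d) → Bad a d k → ¬ Bad a d k′
bad-once a d k k′ 3∤ bad bad′ =
  3∤ (subst (+ 3 Div.∣_) (difference a k k′ (sgn d)) (Div.∣m∣n⇒∣m-n bad bad′))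
  where
  difference : ∀ a k k′ s → (1ℤ * a + k * s) - (1ℤ * a + k′ * s) ≡ (k - k′) * s
  difference = solve-∀

-- Each of the two edges rules out one residue of the coefficient modulo 3.
avoid : ∀ a b d d′ → ∃[ k ] (¬ Bad a d k × ¬ Bad b d′ k)
avoid a b d d′ = choose (bad? a d 0ℤ) (bad? b d′ 0ℤ) (bad? a d 1ℤ) (bad? b d′ 1ℤ)
  where
  bad? : ∀ a d k → Dec (Bad a d k)
  bad? a d k = + 3 Div.∣? (1ℤ * a + k * sgn d)

  3∤1 : ∀ d → ¬ (+ 3 Div.∣ ℤ.-1ℤ * sgn d)
  3∤1 true  = Dec.from-no (+ 3 Div.∣? ℤ.-1ℤ)
  3∤1 false = Dec.from-no (+ 3 Div.∣? 1ℤ)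

  3∤1′ : ∀ d → ¬ (+ 3 Div.∣ 1ℤ * sgn d)
  3∤1′ true  = Dec.from-no (+ 3 Div.∣? 1ℤ)
  3∤1′ false = Dec.from-no (+ 3 Div.∣? ℤ.-1ℤ)

  3∤2 : ∀ d → ¬ (+ 3 Div.∣ + 2 * sgn d)
  3∤2 true  = Dec.from-no (+ 3 Div.∣? + 2)
  3∤2 false = Dec.from-no (+ 3 Div.∣? -[1+ 1 ])

  choose : Dec (Bad a d 0ℤ) → Dec (Bad b d′ 0ℤ) → Dec (Bad a d 1ℤ) → Dec (Bad b d′ 1ℤ) →
           ∃[ k ] (¬ Bad a d k × ¬ Bad b d′ k)
  choose (no ¬a₀) (no ¬b₀) _ _ = 0ℤ , ¬a₀ , ¬b₀
  choose _ _ (no ¬a₁) (no ¬b₁) = 1ℤ , ¬a₁ , ¬b₁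
  choose (yes a₀) _ (yes a₁) _ = ⊥-elim (bad-once a d 0ℤ 1ℤ (3∤1 d) a₀ a₁)
  choose _ (yes b₀) _ (yes b₁) = ⊥-elim (bad-once b d′ 0ℤ 1ℤ (3∤1 d′) b₀ b₁)
  -- Now 0 fails at one edge and 1 at the other. The coefficient -1 differs from these by 1 and 2,
  -- neither a multiple of 3, so it fails at neither edge.
  choose (yes a₀) _ _ (yes b₁) = ℤ.-1ℤ ,
    bad-once a d 0ℤ ℤ.-1ℤ (3∤1′ d) a₀ , bad-once b d′ 1ℤ ℤ.-1ℤ (3∤2 d′) b₁
  choose _ (yes b₀) (yes a₁) _ = ℤ.-1ℤ ,
    bad-once a d 1ℤ ℤ.-1ℤ (3∤2 d) a₁ , bad-once b d′ 0ℤ ℤ.-1ℤ (3∤1′ d′) b₀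

-- Flows of value two, cuts of at most one edge, and even subgraphs.

module Ears (G : Graph) where
  open Flux G
  open Darts G

  Confined : Subset (order G) → Chain → Set
  Confined X N = ∀ e → N e ≡ 0ℤ ⊎ Within X e

  -- For distinct `x` and `y` and positive `j` this plays the part of `j` edge-disjoint paths in
  -- G[X].
  record Flow (X : Subset (order G)) (x y : Vertex G) (j : ℤ) : Set where
    field
      chain    : Chain
      carries  : Carries chain j x y
      values   : ∀ e → Small (chain e)
      confined : Confined X chain

  Inner : Subset (order G) → Subset (order G) → Bool → Edge G → Set
  Inner X R d e = Leaves R d e × hd d e ∈ X

  -- The alternative to two edge-disjoint paths in Menger's theorem: a cut of G[X] with at most one
  -- edge, which `bridge` expresses by identifying any two of its edges.
  record Separation (X : Subset (order G)) (x y : Vertex G) : Set where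
    field
      part   : Subset (order G)
      part⊆X : part ⊆ X
      x∈part : x ∈ part
      y∉part : y ∉ part
      bridge : ∀ d d′ e e′ → Inner X part d e → Inner X part d′ e′ → e ≡ e′

  -- Ford-Fulkerson with unit capacities: a dart is residual unless the flow already uses it fully.
  -- If `y` is not reached, every edge of G[X] leaving `R` carries 1 outwards, so there are exactly
  -- `j` of them, hence at most one.
  augment : ∀ {X x y j} → x ∈ X → y ∈ X → j ℤ.≤ 1ℤ → Flow X x y j →
            Flow X x y (j + 1ℤ) ⊎ Separation X x y
  augment {X} {x} {y} {j} x∈X y∈X j≤1 N = decide (y ∈? R)
    where
    open Flow N

    Residual : Bool → Edge G → Set
    Residual d e = Within X e × chain e ≢ sgn d

    residual? : ∀ d e → Dec (Residual d e)
    residual? d e = ((src e ∈? X) ×-dec (tgt e ∈? X)) ×-dec ¬? (chain e ℤ.≟ sgn d)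

    open Search residual? x

    R        = proj₁ search
    reached  = proj₁ (proj₂ search)
    closed   = proj₂ (proj₂ search)

    R⊆X : R ⊆ X
    R⊆X = reached-⊆ x∈X (λ d e a → within-hd d e (proj₁ a)) reached

    enlarge : ∃[ q ] (Carries q 1ℤ x y × (∀ e → Along R q e)) → Flow X x y (j + 1ℤ)
    enlarge (q , carr , along) = record
      { chain    = combine 1ℤ chain 1ℤ q
      ; carries  = λ p → trans (flux-combine 1ℤ chain 1ℤ q p)
          (trans (cong₂ (λ a b → 1ℤ * a + 1ℤ * b) (carries p) (carr p))
            (add j (p y - p x)))
      ; values   = values′
      ; confined = confined′
      }
      where
      add : ∀ j a → 1ℤ * (j * a) + 1ℤ * (1ℤ * a) ≡ (j + 1ℤ) * a
      add = solve-∀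

      values′ : ∀ e → Small (combine 1ℤ chain 1ℤ q e)
      values′ e with along e
      ... | inj₁ q≡0 = subst Small (sym (1a+1·0 q≡0)) (values e)
      ... | inj₂ ((d , (_ , N≢) , q≡) , _) =
        subst (λ b → Small (1ℤ * chain e + 1ℤ * b)) (sym q≡) (small-push d (values e) N≢)

      confined′ : Confined X (combine 1ℤ chain 1ℤ q)
      confined′ e with along e
      ... | inj₂ (_ , in-R) = inj₂ (within-mono R⊆X in-R)
      ... | inj₁ q≡0 with confined e
      ...   | inj₁ N≡0 = inj₁ (trans (1a+1·0 q≡0) N≡0)
      ...   | inj₂ in-X = inj₂ in-X

    -- The sign turns the net flow into `R` into the flow out of `R`.
    out : Chain
    out e = ℤ.-1ℤ * (chain e * Δ (ind R) e)

    sum-out : y ∉ R → sum out ≡ j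
    sum-out y∉R = trans (sym (*-distribˡ-sum ℤ.-1ℤ (λ e → chain e * Δ (ind R) e)))
      (trans (cong (λ a → ℤ.-1ℤ * a) (carries (ind R)))
        (trans (cong₂ (λ a b → ℤ.-1ℤ * (j * (a - b))) (ind-∉ y∉R) (ind-∈ (root∈ reached)))
          (negate j)))
      where
      negate : ∀ j → ℤ.-1ℤ * (j * (0ℤ - 1ℤ)) ≡ j
      negate = solve-∀

    saturated : ∀ d e → Leaves R d e → Within X e → out e ≡ 1ℤ
    saturated d e (t∈R , h∉R) in-X with chain e ℤ.≟ sgn d
    ... | no N≢ = ⊥-elim (h∉R (closed d e (in-X , N≢) t∈R))
    ... | yes N≡ = trans (cong₂ (λ a b → ℤ.-1ℤ * (a * b)) N≡ (Δ-leaves d e (t∈R , h∉R)))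
                     (by-sign d)
      where
      by-sign : ∀ d → ℤ.-1ℤ * (sgn d * (- sgn d)) ≡ 1ℤ
      by-sign true  = refl
      by-sign false = refl

    out≥0 : ∀ e → 0ℤ ℤ.≤ out e
    out≥0 e with side R e
    ... | inj₁ same = ℤ.≤-reflexive (sym (trans
            (cong (λ a → ℤ.-1ℤ * (chain e * a)) (Δ-same {R} {e} same))
            (cong (λ a → ℤ.-1ℤ * a) (ℤ.*-zeroʳ (chain e)))))
    ... | inj₂ (d , leaves) with confined e
    ...   | inj₁ N≡0 = ℤ.≤-reflexive (sym (trans
            (cong (λ a → ℤ.-1ℤ * (a * Δ (ind R) e)) N≡0)
            (cong (λ a → ℤ.-1ℤ * a) (ℤ.*-zeroˡ (Δ (ind R) e)))))
    ...   | inj₂ in-X = subst (0ℤ ℤ.≤_) (sym (saturated d e leaves in-X)) (ℤ.+≤+ z≤n)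

    separate : y ∉ R → Separation X x y
    separate y∉R = record
      { part   = R
      ; part⊆X = R⊆X
      ; x∈part = root∈ reached
      ; y∉part = y∉R
      ; bridge = unique
      }
      where
      inner-saturated : ∀ d e → Inner X R d e → out e ≡ 1ℤ
      inner-saturated d e ((t∈R , h∉R) , h∈X) =
        saturated d e (t∈R , h∉R) (within d e (R⊆X t∈R) h∈X)

      absurd : 1ℤ + 1ℤ ℤ.≤ 1ℤ → ⊥
      absurd (ℤ.+≤+ (s≤s ()))

      unique : ∀ d d′ e e′ → Inner X R d e → Inner X R d′ e′ → e ≡ e′
      unique d d′ e e′ i i′ with e ≟ e′
      ... | yes e≡e′ = e≡e′
      ... | no e≢e′  = ⊥-elim (absurd (ℤ.≤-trans
              (subst₂ (λ a b → a + b ℤ.≤ sum out)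
                (inner-saturated d e i) (inner-saturated d′ e′ i′)
                (pair≤sum out out≥0 e e′ e≢e′))
              (subst (ℤ._≤ 1ℤ) (sym (sum-out y∉R)) j≤1)))

    decide : Dec (y ∈ R) → Flow X x y (j + 1ℤ) ⊎ Separation X x y
    decide (yes y∈R) = inj₁ (enlarge (reached-flow reached y∈R))
    decide (no y∉R)  = inj₂ (separate y∉R)

  no-flow : ∀ {X x y} → Flow X x y 0ℤ
  no-flow {x = x} {y} = record
    { chain    = λ _ → 0ℤ
    ; carries  = λ p → trans (circulation-zero p) (sym (ℤ.*-zeroˡ (p y - p x)))
    ; values   = λ _ → nil
    ; confined = λ _ → inj₁ refl
    }

  -- The edge set is the support of `cycle`, where all degrees are even since the values are 0, ±1.
  -- Connectedness is `spans`: flows from `x` along the support reach all of `body`. A single vertex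
  -- is allowed, for the case `x` = `y`.
  record EvenSubgraph (X : Subset (order G)) (x y : Vertex G) : Set where
    field
      body   : Subset (order G)
      body⊆X : body ⊆ X
      x∈body : x ∈ body
      y∈body : y ∈ body
      cycle  : Chain
      circ   : Circulation cycle
      values : ∀ e → Small (cycle e)
      inside : Confined body cycle
      spans  : ∀ {w} → w ∈ body →
               ∃[ q ] (Carries q 1ℤ x w × (∀ e → q e ≡ 0ℤ ⊎ cycle e ≢ 0ℤ))

  -- Take the set `R` reachable from `x` along the flow. No flow leaves `R`, so `y` lies in `R`,
  -- since otherwise a net flow of 2 would have to leave. Then the net flow across the boundary is
  -- 0, so the flow vanishes there and can be restricted to `R`.
  even-subgraph : ∀ {X x y} → x ∈ X → Flow X x y (+ 2) → EvenSubgraph X x y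
  even-subgraph {X} {x} {y} x∈X N = result
    where
    open Flow N using (chain; carries; values; confined)

    Forward : Bool → Edge G → Set
    Forward d e = chain e ≡ sgn d

    open Search {Forward} (λ d e → chain e ℤ.≟ sgn d) x

    R        = proj₁ search
    reached  = proj₁ (proj₂ search)
    closed   = proj₂ (proj₂ search)

    R⊆X : R ⊆ X
    R⊆X = reached-⊆ x∈X head∈X reached
      where
      head∈X : ∀ d e → chain e ≡ sgn d → hd d e ∈ X
      head∈X d e N≡ with confined e
      ... | inj₁ N≡0 = ⊥-elim (sgn≢0 d (trans (sym N≡) N≡0))
      ... | inj₂ in-X = within-hd d e in-X

    cross : Chain
    cross e = chain e * Δ (ind R) e

    cross-leaves : ∀ d e → Leaves R d e → cross e ≡ - (sgn d * chain e)
    cross-leaves d e leaves =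
      trans (cong (chain e *_) (Δ-leaves d e leaves)) (a*-b≡-[b*a] (chain e) (sgn d))

    not-forward : ∀ d e → Leaves R d e → chain e ≢ sgn d
    not-forward d e (t∈R , h∉R) N≡ = h∉R (closed d e N≡ t∈R)

    cross≥0 : ∀ e → 0ℤ ℤ.≤ cross e
    cross≥0 e with side R e
    ... | inj₁ same = ℤ.≤-reflexive (sym (trans
            (cong (chain e *_) (Δ-same {R} {e} same)) (ℤ.*-zeroʳ (chain e))))
    ... | inj₂ (d , leaves) = subst (0ℤ ℤ.≤_) (sym (cross-leaves d e leaves))
            (small-against d (values e) (not-forward d e leaves))

    y∈R : y ∈ R
    y∈R with y ∈? R
    ... | yes y∈R = y∈R
    ... | no y∉R = ⊥-elim (absurd (subst (0ℤ ℤ.≤_) net (sum-0≤ cross cross≥0)))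
      where
      net : sum cross ≡ + 2 * (0ℤ - 1ℤ)
      net = trans (carries (ind R))
        (cong₂ (λ a b → + 2 * (a - b)) (ind-∉ y∉R) (ind-∈ (root∈ reached)))
      absurd : 0ℤ ℤ.≤ + 2 * (0ℤ - 1ℤ) → ⊥
      absurd ()

    net-0 : sum cross ≡ 0ℤ
    net-0 = trans (carries (ind R))
      (cong₂ (λ a b → + 2 * (a - b)) (ind-∈ y∈R) (ind-∈ (root∈ reached)))

    leaves⇒0 : ∀ d e → Leaves R d e → chain e ≡ 0ℤ
    leaves⇒0 d e leaves = small-against-0 d (values e) (not-forward d e leaves)
      (subst₂ ℤ._≤_ (cross-leaves d e leaves) net-0 (term≤sum cross cross≥0 e))

    settled : ∀ e → chain e ≡ 0ℤ ⊎ Within R e ⊎ (src e ∉ R × tgt e ∉ R)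
    settled e with src e ∈? R | tgt e ∈? R
    ... | yes s∈R | yes t∈R = inj₂ (inj₁ (s∈R , t∈R))
    ... | no s∉R  | no t∉R  = inj₂ (inj₂ (s∉R , t∉R))
    ... | yes s∈R | no t∉R  = inj₁ (leaves⇒0 true e (s∈R , t∉R))
    ... | no s∉R  | yes t∈R = inj₁ (leaves⇒0 false e (t∈R , s∉R))

    flow  = reached-flow reached y∈R
    path  = proj₁ flow

    -- Reversing the flow along one path turns a flow of value 2 into a
    -- circulation with the same support.
    turned : Chain
    turned = combine 1ℤ chain (- (+ 2)) path

    turned-circ : Circulation turned
    turned-circ = carries-close (+ 2) chain path carries (proj₁ (proj₂ flow))

    turned-value : ∀ e → turned e ≡ chain e ⊎
                         (∃[ d ] (chain e ≡ sgn d × turned e ≡ sgn (not d)))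
    turned-value e with proj₂ (proj₂ flow) e
    ... | inj₁ q≡0 = inj₁ (trans (cong (λ b → 1ℤ * chain e + (- (+ 2)) * b) q≡0)
                       (trans (ℤ.+-identityʳ _) (ℤ.*-identityˡ (chain e))))
    ... | inj₂ ((d , N≡ , q≡) , _) =
      inj₂ (d , N≡ , trans (cong₂ (λ a b → 1ℤ * a + (- (+ 2)) * b) N≡ q≡) (by-sign d))
      where
      by-sign : ∀ d → 1ℤ * sgn d + (- (+ 2)) * sgn d ≡ sgn (not d)
      by-sign true  = refl
      by-sign false = refl

    turned-small : ∀ e → Small (turned e)
    turned-small e with turned-value e
    ... | inj₁ eq           = subst Small (sym eq) (values e)
    ... | inj₂ (d , _ , eq) = subst Small (sym eq) (one (not d))

    turned-0 : ∀ e → chain e ≡ 0ℤ → turned e ≡ 0ℤ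
    turned-0 e N≡0 with turned-value e
    ... | inj₁ eq           = trans eq N≡0
    ... | inj₂ (d , N≡ , _) = ⊥-elim (sgn≢0 d (trans (sym N≡) N≡0))

    turned-≢0 : ∀ d e → chain e ≡ sgn d → turned e ≢ 0ℤ
    turned-≢0 d e N≡ t≡0 with turned-value e
    ... | inj₁ eq            = sgn≢0 d (trans (sym N≡) (trans (sym eq) t≡0))
    ... | inj₂ (d′ , _ , eq) = sgn≢0 (not d′) (trans (sym eq) t≡0)

    cycle : Chain
    -- Testing one end suffices: by `settled` no edge of the support has exactly one end in `R`.
    cycle e = ind R (src e) * turned e

    cycle-in : ∀ e → src e ∈ R → cycle e ≡ turned e
    cycle-in e s∈R = trans (cong (_* turned e) (ind-∈ s∈R)) (ℤ.*-identityˡ (turned e))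

    cycle-out : ∀ e → src e ∉ R → cycle e ≡ 0ℤ
    cycle-out e s∉R = trans (cong (_* turned e) (ind-∉ s∉R)) (ℤ.*-zeroˡ (turned e))

    cycle-0 : ∀ e → chain e ≡ 0ℤ → cycle e ≡ 0ℤ
    cycle-0 e N≡0 = trans (cong (ind R (src e) *_) (turned-0 e N≡0)) (ℤ.*-zeroʳ (ind R (src e)))

    -- Cutting the chain down to `R` has the same effect as cutting the potential down to `R`,
    -- because the support does not cross the boundary. So `cycle` inherits conservation from
    -- `turned`.
    localise : ∀ p e → cycle e * Δ p e ≡ turned e * Δ (λ v → ind R v * p v) e
    localise p e with settled e
    ... | inj₁ N≡0 = trans (cong (_* Δ p e) (cycle-0 e N≡0))
            (trans (ℤ.*-zeroˡ (Δ p e))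
              (sym (trans (cong (_* Δ (λ v → ind R v * p v) e) (turned-0 e N≡0))
                (ℤ.*-zeroˡ (Δ (λ v → ind R v * p v) e)))))
    ... | inj₂ (inj₁ (s∈R , t∈R)) = trans (cong (_* Δ p e) (cycle-in e s∈R))
            (cong (turned e *_) (sym (trans
              (cong₂ (λ a b → a * p (tgt e) - b * p (src e)) (ind-∈ t∈R) (ind-∈ s∈R))
              (cong₂ _-_ (ℤ.*-identityˡ (p (tgt e))) (ℤ.*-identityˡ (p (src e)))))))
    ... | inj₂ (inj₂ (s∉R , t∉R)) = trans (cong (_* Δ p e) (cycle-out e s∉R))
            (trans (ℤ.*-zeroˡ (Δ p e)) (sym (trans
              (cong₂ (λ a b → turned e * (a * p (tgt e) - b * p (src e)))
                (ind-∉ t∉R) (ind-∉ s∉R))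
              (trans (cong₂ (λ a b → turned e * (a - b))
                       (ℤ.*-zeroˡ (p (tgt e))) (ℤ.*-zeroˡ (p (src e))))
                (ℤ.*-zeroʳ (turned e))))))

    cycle-small : ∀ e → Small (cycle e)
    cycle-small e with src e ∈? R
    ... | yes _ = subst Small (sym (ℤ.*-identityˡ (turned e))) (turned-small e)
    ... | no _  = nil

    inside : Confined R cycle
    inside e with settled e
    ... | inj₁ N≡0               = inj₁ (cycle-0 e N≡0)
    ... | inj₂ (inj₁ in-R)       = inj₂ in-R
    ... | inj₂ (inj₂ (s∉R , _))  = inj₁ (cycle-out e s∉R)

    supported : ∀ q e → Along R q e → q e ≡ 0ℤ ⊎ cycle e ≢ 0ℤ
    supported q e (inj₁ q≡0) = inj₁ q≡0
    supported q e (inj₂ ((d , N≡ , _) , s∈R , _)) =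
      inj₂ (λ c≡0 → turned-≢0 d e N≡ (trans (sym (cycle-in e s∈R)) c≡0))

    spans : ∀ {w} → w ∈ R → ∃[ q ] (Carries q 1ℤ x w × (∀ e → q e ≡ 0ℤ ⊎ cycle e ≢ 0ℤ))
    spans w∈R = relax (reached-flow reached w∈R)
      where
      relax : ∃[ q ] (Carries q 1ℤ x _ × (∀ e → Along R q e)) → _
      relax (q , carr , along) = q , carr , λ e → supported q e (along e)

    result : EvenSubgraph X x y
    result = record
      { body   = R
      ; body⊆X = R⊆X
      ; x∈body = root∈ reached
      ; y∈body = y∈R
      ; cycle  = cycle
      ; circ   = λ p → trans (sum-cong-≗ (localise p)) (turned-circ (λ v → ind R v * p v))
      ; values = cycle-small
      ; inside = inside
      ; spans  = spans
      }

  connect : ∀ {X x y} → x ∈ X → y ∈ X → EvenSubgraph X x y ⊎ Separation X x y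
  connect {X} {x} {y} x∈X y∈X = first (augment x∈X y∈X (ℤ.+≤+ z≤n) no-flow)
    where
    second : Flow X x y (+ 2) ⊎ Separation X x y → EvenSubgraph X x y ⊎ Separation X x y
    second (inj₁ N) = inj₁ (even-subgraph x∈X N)
    second (inj₂ s) = inj₂ s

    first : Flow X x y 1ℤ ⊎ Separation X x y → EvenSubgraph X x y ⊎ Separation X x y
    first (inj₁ N) = second (augment x∈X y∈X (ℤ.+≤+ (s≤s z≤n)) N)
    first (inj₂ s) = inj₂ s

-- Growing a connected subgraph by edges and ears.

support : ∀ {n} → (Fin n → ℤ) → Subset n
support g = tabulate (λ e → not (does (g e ℤ.≟ 0ℤ)))

∈-support : ∀ {n} {g : Fin n → ℤ} {e} → g e ≢ 0ℤ → e ∈ support g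
∈-support {g = g} {e} g≢0 = lookup⇒[]= e (support g) (trans (lookup∘tabulate _ e) computed)
  where
  computed : not (does (g e ℤ.≟ 0ℤ)) ≡ true
  computed with g e ℤ.≟ 0ℤ
  ... | yes g≡0 = ⊥-elim (g≢0 g≡0)
  ... | no _    = refl

∈-support⁻ : ∀ {n} {g : Fin n → ℤ} {e} → e ∈ support g → g e ≢ 0ℤ
∈-support⁻ {g = g} {e} e∈ g≡0
  with trans (sym (lookup∘tabulate _ e)) ([]=⇒lookup e∈)
... | member rewrite g≡0 with member
...   | ()

module Growth (G : Graph) (conn : EdgeConnected 3 G) where
  open Flux G
  open Darts G
  open Positive G
  open Cut conn
  open Ears G

  hd-not : ∀ d e → hd (not d) e ≡ tl d e
  hd-not true  e = refl
  hd-not false e = refl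

  tl-not : ∀ d e → tl (not d) e ≡ hd d e
  tl-not true  e = refl
  tl-not false e = refl

  -- An ear is attached to S by the edges entry and exit, whose ends outside
  -- S are joined by a connected even subgraph.
  record Ear (S : Subset (order G)) : Set where
    field
      d₁ d₂       : Bool
      entry exit  : Edge G
      entry≢exit  : entry ≢ exit
      from-S      : tl d₁ entry ∈ S
      to-S        : tl d₂ exit ∈ S
      even        : EvenSubgraph (∁ S) (hd d₁ entry) (hd d₂ exit)

  Exit : Subset (order G) → Subset (order G) → Bool → Edge G → Set
  Exit S X d e = Leaves X d e × hd d e ∉ S

  -- At most one edge joins `X` to vertices outside both `X` and `S`. For nonempty `S`,
  -- 3-edge-connectivity then leaves at least two edges between `X` and `S`, the possible ends of an
  -- ear.
  record Candidate (S X : Subset (order G)) : Set where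
    field
      member   : Vertex G
      member∈X : member ∈ X
      X∩S≡∅    : ∀ {v} → v ∈ X → v ∉ S
      unique   : ∀ d d′ e e′ → Exit S X d e → Exit S X d′ e′ → e ≡ e′

  -- The only edge that may escape from `X` past `S` starts on one side of the separation. The other
  -- side has no exits except through the bridge, hence at most one, and is again a candidate.
  separate : ∀ {S X x y} → y ∈ X → Candidate S X → Separation X x y →
             ∃[ Y ] (Y ⊂ X × Candidate S Y)
  separate {S} {X} {x} {y} y∈X C sep = choose (anyDart? escape?)
    where
    open Candidate C
    open Separation sep

    rest : Subset (order G)
    rest = X ∩ ∁ part

    Escape : Bool → Edge G → Set
    Escape d e = tl d e ∈ part × Exit S X d e

    escape? : ∀ d e → Dec (Escape d e)
    escape? d e = (tl d e ∈? part) ×-dec leaves? X d e ×-dec ¬? (hd d e ∈? S)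

    ∈rest : ∀ {v} → v ∈ X → v ∉ part → v ∈ rest
    ∈rest v∈X v∉P = x∈p∩q⁺ (v∈X , x∉p⇒x∈∁p v∉P)

    rest⊆X : rest ⊆ X
    rest⊆X = p∩q⊆p X (∁ part)

    rest∌ : ∀ {v} → v ∈ rest → v ∉ part
    rest∌ v∈ = x∈∁p⇒x∉p (p∩q⊆q X (∁ part) v∈)

    whole : (∀ d e → ¬ Escape d e) → Candidate S part
    whole none = record
      { member   = x
      ; member∈X = x∈part
      ; X∩S≡∅    = X∩S≡∅ ∘ part⊆X
      ; unique   = λ d d′ e e′ o o′ → bridge d d′ e e′ (inner d e o) (inner d′ e′ o′)
      }
      where
      inner : ∀ d e → Exit S part d e → Inner X part d e
      inner d e ((t∈ , h∉) , h∉S) with hd d e ∈? X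
      ... | yes h∈X = (t∈ , h∉) , h∈X
      ... | no h∉X  = ⊥-elim (none d e (t∈ , (part⊆X t∈ , h∉X) , h∉S))

    remaining : ∃[ d ] ∃[ e ] Escape d e → Candidate S rest
    remaining (d₀ , e₀ , t₀∈ , out₀) = record
      { member   = y
      ; member∈X = ∈rest y∈X y∉part
      ; X∩S≡∅    = X∩S≡∅ ∘ rest⊆X
      ; unique   = λ d d′ e e′ o o′ →
          bridge (not d) (not d′) e e′ (inner d e o) (inner d′ e′ o′)
      }
      where
      inner : ∀ d e → Exit S rest d e → Inner X part (not d) e
      inner d e ((t∈ , h∉) , h∉S) with hd d e ∈? X
      ... | no h∉X with unique d d₀ e e₀ ((rest⊆X t∈ , h∉X) , h∉S) out₀
      ...   | refl with leaves-unique {X} {d} {d₀} (rest⊆X t∈ , h∉X) (proj₁ out₀)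
      ...     | refl = ⊥-elim (rest∌ t∈ t₀∈)
      inner d e ((t∈ , h∉) , h∉S) | yes h∈X with hd d e ∈? part
      ... | no h∉P = ⊥-elim (h∉ (∈rest h∈X h∉P))
      ... | yes h∈P =
        ( subst (_∈ part) (sym (tl-not d e)) h∈P
        , λ t∈P → rest∌ t∈ (subst (_∈ part) (hd-not d e) t∈P) ) ,
        subst (_∈ X) (sym (hd-not d e)) (rest⊆X t∈)

    choose : Dec (∃[ d ] ∃[ e ] Escape d e) → ∃[ Y ] (Y ⊂ X × Candidate S Y)
    choose (no none) =
      part , (part⊆X , y , y∈X , y∉part) , whole (λ d e esc → none (d , e , esc))
    choose (yes esc) =
      rest , (rest⊆X , x , part⊆X x∈part , λ x∈ → rest∌ x∈ x∈part) , remaining esc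

  -- Take two edges from `X` to `S`. Either their ends in `X` lie in a common even subgraph, which
  -- gives an ear, or they are separated by at most one edge and a strictly smaller candidate takes
  -- over.
  find-ear : ∀ {S r X} → r ∈ S → Candidate S X → Acc _⊂_ X → Ear S
  find-ear {S} {r} {X} r∈S C (acc rec) = attach (exits (anyDart? exit?))
    where
    open Candidate C

    exit? : ∀ d e → Dec (Exit S X d e)
    exit? d e = leaves? X d e ×-dec ¬? (hd d e ∈? S)

    -- Once `F` is excluded, an edge leaving `X` must end in `S`. Excluding also the first edge
    -- found makes at most two, within the bound of `crossing`.
    Covers : EdgeSet G → Set
    Covers F = ∣ F ∣ ≤ 1 × (∀ d e → Exit S X d e → e ∈ F)

    exits : Dec (∃[ d ] ∃[ e ] Exit S X d e) → ∃[ F ] Covers F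
    exits (yes (d₀ , e₀ , o₀)) = ⁅ e₀ ⁆ , ℕ.≤-reflexive (∣⁅x⁆∣≡1 e₀) ,
      λ d e o → subst (_∈ ⁅ e₀ ⁆) (unique d₀ d e₀ e o₀ o) (x∈⁅x⁆ e₀)
    exits (no none) = ∅ , ℕ.≤-trans (ℕ.≤-reflexive (∣⊥∣≡0 (size G))) z≤n ,
      λ d e o → ⊥-elim (none (d , e , o))

    r∉X : r ∉ X
    r∉X r∈X = X∩S≡∅ r∈X r∈S

    attach : ∃[ F ] Covers F → Ear S
    attach (F , ∣F∣≤1 , covers) = first (crossing F (s≤s (ℕ.≤-trans ∣F∣≤1 (s≤s z≤n))) member∈X r∉X)
      where
      in-S : ∀ d e → e ∉ F → Leaves X d e → hd d e ∈ S
      in-S d e e∉F out with hd d e ∈? S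
      ... | yes h∈S = h∈S
      ... | no h∉S  = ⊥-elim (e∉F (covers d e (out , h∉S)))

      first : ∃[ d ] ∃[ e ] (e ∉ F × Leaves X d e) → Ear S
      first (d₁ , e₁ , e₁∉F , out₁) = second
        (crossing (F ∪ ⁅ e₁ ⁆) (s≤s (ℕ.≤-trans (∣p∪⁅x⁆∣≤1+∣p∣ F e₁) (s≤s ∣F∣≤1))) member∈X r∉X)
        where
        second : ∃[ d ] ∃[ e ] (e ∉ F ∪ ⁅ e₁ ⁆ × Leaves X d e) → Ear S
        second (d₂ , e₂ , e₂∉ , out₂) = finish (connect x∈X y∈X)
          where
          x∈X : hd (not d₁) e₁ ∈ X
          x∈X = subst (_∈ X) (sym (hd-not d₁ e₁)) (proj₁ out₁)

          y∈X : hd (not d₂) e₂ ∈ X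
          y∈X = subst (_∈ X) (sym (hd-not d₂ e₂)) (proj₁ out₂)

          smaller : ∃[ Y ] (Y ⊂ X × Candidate S Y) → Ear S
          smaller (Y , Y⊂X , C′) = find-ear r∈S C′ (rec Y⊂X)

          finish : EvenSubgraph X (hd (not d₁) e₁) (hd (not d₂) e₂) ⊎
                   Separation X (hd (not d₁) e₁) (hd (not d₂) e₂) → Ear S
          finish (inj₂ sep) = smaller (separate y∈X C sep)
          finish (inj₁ E) = record
            -- The two edges were found leaving `X`, while an ear directs both from `S` to its body.
            { d₁         = not d₁
            ; d₂         = not d₂
            ; entry      = e₁
            ; exit       = e₂
            ; entry≢exit = λ { refl → e₂∉ (q⊆p∪q F ⁅ e₁ ⁆ (x∈⁅x⁆ e₁)) }
            ; from-S     = subst (_∈ S) (sym (tl-not d₁ e₁)) (in-S d₁ e₁ e₁∉F out₁)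
            ; to-S       = subst (_∈ S) (sym (tl-not d₂ e₂))
                             (in-S d₂ e₂ (e₂∉ ∘ p⊆p∪q ⁅ e₁ ⁆) out₂)
            ; even       = record
              { body   = body
              ; body⊆X = λ v∈ → x∉p⇒x∈∁p (X∩S≡∅ (body⊆X v∈))
              ; x∈body = x∈body
              ; y∈body = y∈body
              ; cycle  = cycle
              ; circ   = circ
              ; values = values
              ; inside = inside
              ; spans  = spans
              }
            }
            where open EvenSubgraph E

  ear : ∀ {S r v} → r ∈ S → v ∉ S → Ear S
  ear {S} {r} {v} r∈S v∉S = find-ear r∈S all-outside (⊂-wellFounded (∁ S))
    where
    all-outside : Candidate S (∁ S)
    all-outside = record
      { member   = v
      ; member∈X = x∉p⇒x∈∁p v∉S
      ; X∩S≡∅    = x∈∁p⇒x∉p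
      ; unique   = λ { d d′ e e′ ((_ , h∉) , h∉S) _ → ⊥-elim (h∉ (x∉p⇒x∈∁p h∉S)) }
      }

  -- One stage of the growth: the subgraph with vertices `S` and edges `T`, connected in the sense
  -- of `reach`, and the part of Seymour's 2-flow built so far.
  record Skeleton (r : Vertex G) : Set where
    field
      S       : Subset (order G)
      T       : EdgeSet G
      g       : Chain
      T⊆S     : ∀ {e} → e ∈ T → Within S e
      r∈S     : r ∈ S
      reach   : ∀ {w} → w ∈ S → ∃[ q ] (Carries q 1ℤ r w × (∀ e → e ∉ T → q e ≡ 0ℤ))
      g-circ  : Circulation g
      g-small : ∀ e → Small (g e)
      g-supp  : ∀ e → e ∉ T → g e ≡ 0ℤ

  -- The outcome of all stages after `T`: the final 2-flow, and an `f` already corrected outside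
  -- `T`. Edges in `T` are still open, so empty `T` gives the full decomposition.
  record Completion (T : EdgeSet G) (g : Chain) : Set where
    field
      g*       : Chain
      f        : Chain
      g*-circ  : Circulation g*
      f-circ   : Circulation f
      g*-small : ∀ e → Small (g* e)
      agree    : ∀ {e} → e ∈ T → g* e ≡ g e
      covered  : ∀ e → e ∉ T → g* e ≢ 0ℤ ⊎ ¬ (+ 3 Div.∣ f e)

  -- Adding a multiple of `c` changes `f` only on `T′`, so earlier corrections survive. Of the edges
  -- in `T′` but not in `T`, all but `a` and `b` are covered by the 2-flow, and `avoid` supplies a
  -- coefficient good at both.
  adjust : ∀ {T T′ g g′} → T ⊆ T′ → (∀ {e} → e ∈ T → g′ e ≡ g e) →
           ∀ c → Circulation c → (∀ e → e ∉ T′ → c e ≡ 0ℤ) →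
           ∀ a b d d′ → c a ≡ sgn d → c b ≡ sgn d′ →
           (∀ e → e ∈ T′ → e ∉ T → e ≡ a ⊎ e ≡ b ⊎ g′ e ≢ 0ℤ) →
           Completion T′ g′ → Completion T g
  adjust {T} {T′} {g} {g′} T⊆T′ g′≡g c c-circ c-supp a b d d′ ca cb new K =
    correct (avoid (f a) (f b) d d′)
    where
    open Completion K

    correct : ∃[ k ] (¬ Bad (f a) d k × ¬ Bad (f b) d′ k) → Completion T g
    correct (k , good-a , good-b) = record
      { g*       = g*
      ; f        = combine 1ℤ f k c
      ; g*-circ  = g*-circ
      ; f-circ   = circulation-combine 1ℤ f k c f-circ c-circ
      ; g*-small = g*-small
      ; agree    = λ e∈T → trans (agree (T⊆T′ e∈T)) (g′≡g e∈T)
      ; covered  = covered′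
      }
      where
      on : ∀ {e s} → c e ≡ s → ¬ (+ 3 Div.∣ (1ℤ * f e + k * s)) →
           ¬ (+ 3 Div.∣ combine 1ℤ f k c e)
      on {e} c≡ 3∤ = subst (λ s → ¬ (+ 3 Div.∣ (1ℤ * f e + k * s))) (sym c≡) 3∤

      untouched : ∀ {e} → c e ≡ 0ℤ → combine 1ℤ f k c e ≡ f e
      untouched {e} c≡0 = trans (cong (λ s → 1ℤ * f e + k * s) c≡0)
        (trans (cong₂ _+_ (ℤ.*-identityˡ (f e)) (ℤ.*-zeroʳ k)) (ℤ.+-identityʳ (f e)))

      covered′ : ∀ e → e ∉ T → g* e ≢ 0ℤ ⊎ ¬ (+ 3 Div.∣ combine 1ℤ f k c e)
      covered′ e e∉T with e ∈? T′
      ... | yes e∈T′ with new e e∈T′ e∉T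
      ...   | inj₁ refl        = inj₂ (on ca good-a)
      ...   | inj₂ (inj₁ refl) = inj₂ (on cb good-b)
      ...   | inj₂ (inj₂ g′≢0) = inj₁ (λ g*≡0 → g′≢0 (trans (sym (agree e∈T′)) g*≡0))
      covered′ e e∉T | no e∉T′ with covered e e∉T′
      ... | inj₁ g*≢0 = inj₁ g*≢0
      ... | inj₂ 3∤f  = inj₂ (subst (λ a → ¬ (+ 3 Div.∣ a))
                          (sym (untouched (c-supp e e∉T′))) 3∤f)

  module AddEdge {r} (K : Skeleton r) {e₀ : Edge G}
                 (e₀∉T : e₀ ∉ Skeleton.T K) (e₀∈S : Within (Skeleton.S K) e₀) where
    open Skeleton K

    T′ : EdgeSet G
    T′ = T ∪ ⁅ e₀ ⁆

    old : T ⊆ T′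
    old = p⊆p∪q ⁅ e₀ ⁆

    new⁻ : ∀ {e} → e ∈ T′ → e ∈ T ⊎ e ≡ e₀
    new⁻ e∈ with x∈p∪q⁻ T ⁅ e₀ ⁆ e∈
    ... | inj₁ e∈T = inj₁ e∈T
    ... | inj₂ e∈₀ = inj₂ (x∈⁅y⁆⇒x≡y e₀ e∈₀)

    extended : Skeleton r
    extended = record
      { S       = S
      ; T       = T′
      ; g       = g
      ; T⊆S     = λ e∈ → in-S (new⁻ e∈)
      ; r∈S     = r∈S
      ; reach   = λ w∈S → widen (reach w∈S)
      ; g-circ  = g-circ
      ; g-small = g-small
      ; g-supp  = λ e e∉ → g-supp e (e∉ ∘ old)
      }
      where
      in-S : ∀ {e} → e ∈ T ⊎ e ≡ e₀ → Within S e
      in-S (inj₁ e∈T)  = T⊆S e∈T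
      in-S (inj₂ refl) = e₀∈S

      widen : ∀ {w} → ∃[ q ] (Carries q 1ℤ r w × (∀ e → e ∉ T → q e ≡ 0ℤ)) →
              ∃[ q ] (Carries q 1ℤ r w × (∀ e → e ∉ T′ → q e ≡ 0ℤ))
      widen (q , carr , supp) = q , carr , λ e e∉ → supp e (e∉ ∘ old)

    back : Completion T′ g → Completion T g
    back = close (reach (proj₁ e₀∈S)) (reach (proj₂ e₀∈S))
      where
      close : ∃[ q ] (Carries q 1ℤ r (src e₀) × (∀ e → e ∉ T → q e ≡ 0ℤ)) →
              ∃[ q ] (Carries q 1ℤ r (tgt e₀) × (∀ e → e ∉ T → q e ≡ 0ℤ)) →
              Completion T′ g → Completion T g
      close (q , q-carr , q-supp) (q′ , q′-carr , q′-supp) =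
        -- With a single new edge, `e₀` takes both places. Here `c` runs from `r` to one end of
        -- `e₀`, along `e₀`, and back to `r` through `T`.
        adjust old (λ _ → refl) c c-circ c-off e₀ e₀ true true c-on c-on
          (λ e e∈ e∉ → only (new⁻ e∈) e∉)
        where
        c : Chain
        c = combine 1ℤ (combine 1ℤ q 1ℤ (unit true e₀)) (- 1ℤ) q′

        c-circ : Circulation c
        c-circ = carries-close 1ℤ (combine 1ℤ q 1ℤ (unit true e₀)) q′
          (carries-++ q (unit true e₀) q-carr (unit-carries true e₀)) q′-carr

        value : ∀ {a b x y} → a ≡ 0ℤ → b ≡ y → x ≡ 0ℤ →
                1ℤ * (1ℤ * a + 1ℤ * b) + (- 1ℤ) * x ≡ y
        value {b = b} refl refl refl = lemma b
          where
          lemma : ∀ b → 1ℤ * (1ℤ * 0ℤ + 1ℤ * b) + (- 1ℤ) * 0ℤ ≡ b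
          lemma = solve-∀

        c-on : c e₀ ≡ 1ℤ
        c-on = value {y = 1ℤ} (q-supp e₀ e₀∉T) (unit-on true e₀) (q′-supp e₀ e₀∉T)

        c-off : ∀ e → e ∉ T′ → c e ≡ 0ℤ
        c-off e e∉ = value {y = 0ℤ} (q-supp e (e∉ ∘ old))
          (unit-off true {e₀} {e} (λ { refl → e∉ (q⊆p∪q T ⁅ e₀ ⁆ (x∈⁅x⁆ e₀)) }))
          (q′-supp e (e∉ ∘ old))

        only : ∀ {e} → e ∈ T ⊎ e ≡ e₀ → e ∉ T → e ≡ e₀ ⊎ e ≡ e₀ ⊎ g e ≢ 0ℤ
        only (inj₁ e∈T) e∉T = ⊥-elim (e∉T e∈T)
        only (inj₂ e≡)  _   = inj₁ e≡

  module AddEar {r} (K : Skeleton r) (E : Ear (Skeleton.S K)) where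
    open Skeleton K
    open Ear E
    open EvenSubgraph even

    S′ : Subset (order G)
    S′ = S ∪ body

    T′ : EdgeSet G
    T′ = ((T ∪ ⁅ entry ⁆) ∪ ⁅ exit ⁆) ∪ support cycle

    g′ : Chain
    g′ = combine 1ℤ g 1ℤ cycle

    body∌S : ∀ {v} → v ∈ body → v ∉ S
    body∌S v∈ = x∈∁p⇒x∉p (body⊆X v∈)

    T⊆T′ : T ⊆ T′
    T⊆T′ = p⊆p∪q _ ∘ p⊆p∪q _ ∘ p⊆p∪q _

    entry∈T′ : entry ∈ T′
    entry∈T′ = p⊆p∪q _ (p⊆p∪q _ (q⊆p∪q T ⁅ entry ⁆ (x∈⁅x⁆ entry)))

    exit∈T′ : exit ∈ T′
    exit∈T′ = p⊆p∪q _ (q⊆p∪q (T ∪ ⁅ entry ⁆) ⁅ exit ⁆ (x∈⁅x⁆ exit))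

    cycle∈T′ : ∀ {e} → cycle e ≢ 0ℤ → e ∈ T′
    cycle∈T′ c≢0 = q⊆p∪q ((T ∪ ⁅ entry ⁆) ∪ ⁅ exit ⁆) (support cycle) (∈-support {g = cycle} c≢0)

    T′⁻ : ∀ {e} → e ∈ T′ → e ∈ T ⊎ e ≡ entry ⊎ e ≡ exit ⊎ cycle e ≢ 0ℤ
    T′⁻ e∈ with x∈p∪q⁻ ((T ∪ ⁅ entry ⁆) ∪ ⁅ exit ⁆) (support cycle) e∈
    ... | inj₂ e∈supp = inj₂ (inj₂ (inj₂ (∈-support⁻ {g = cycle} e∈supp)))
    ... | inj₁ e∈₁ with x∈p∪q⁻ (T ∪ ⁅ entry ⁆) ⁅ exit ⁆ e∈₁
    ...   | inj₂ e∈exit = inj₂ (inj₂ (inj₁ (x∈⁅y⁆⇒x≡y exit e∈exit)))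
    ...   | inj₁ e∈₂ with x∈p∪q⁻ T ⁅ entry ⁆ e∈₂
    ...     | inj₁ e∈T     = inj₁ e∈T
    ...     | inj₂ e∈entry = inj₂ (inj₁ (x∈⁅y⁆⇒x≡y entry e∈entry))

    off-body : ∀ d e → tl d e ∈ S → cycle e ≡ 0ℤ
    off-body d e t∈S with inside e
    ... | inj₁ c≡0     = c≡0
    ... | inj₂ in-body = ⊥-elim (body∌S (within-tl d e in-body) t∈S)

    T-off-body : ∀ {e} → e ∈ T → cycle e ≡ 0ℤ
    T-off-body {e} e∈T = off-body true e (proj₁ (T⊆S e∈T))

    entry∉T : entry ∉ T
    entry∉T e∈T = body∌S x∈body (within-hd d₁ entry (T⊆S e∈T))

    exit∉T : exit ∉ T
    exit∉T e∈T = body∌S y∈body (within-hd d₂ exit (T⊆S e∈T))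

    Path : Vertex G → Set
    Path w = ∃[ q ] (Carries q 1ℤ r w × (∀ e → e ∉ T′ → q e ≡ 0ℤ))

    off-T′ : ∀ {q : Chain} e → q e ≡ 0ℤ ⊎ cycle e ≢ 0ℤ → e ∉ T′ → q e ≡ 0ℤ
    off-T′ e (inj₁ q≡0) _  = q≡0
    off-T′ e (inj₂ c≢0) e∉ = ⊥-elim (e∉ (cycle∈T′ c≢0))

    sum-0 : ∀ {a b} → a ≡ 0ℤ → b ≡ 0ℤ → 1ℤ * a + 1ℤ * b ≡ 0ℤ
    sum-0 refl refl = refl

    through : ∀ {w} → ∃[ q ] (Carries q 1ℤ r (tl d₁ entry) × (∀ e → e ∉ T → q e ≡ 0ℤ)) →
              ∃[ q ] (Carries q 1ℤ (hd d₁ entry) w × (∀ e → q e ≡ 0ℤ ⊎ cycle e ≢ 0ℤ)) →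
              Path w
    through (q , q-carr , q-supp) (p , p-carr , p-supp) =
      combine 1ℤ (combine 1ℤ q 1ℤ (unit d₁ entry)) 1ℤ p ,
      carries-++ (combine 1ℤ q 1ℤ (unit d₁ entry)) p
        (carries-++ q (unit d₁ entry) q-carr (unit-carries d₁ entry)) p-carr ,
      λ e e∉ → sum-0
        (sum-0 (q-supp e (e∉ ∘ T⊆T′)) (unit-off d₁ {entry} {e} (λ { refl → e∉ entry∈T′ })))
        (off-T′ {p} e (p-supp e) e∉)

    extended : Skeleton r
    extended = record
      { S       = S′
      ; T       = T′
      ; g       = g′
      ; T⊆S     = λ {e} e∈ → in-S′ e (T′⁻ e∈)
      ; r∈S     = p⊆p∪q body r∈S
      ; reach   = λ w∈ → reach′ (x∈p∪q⁻ S body w∈)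
      ; g-circ  = circulation-combine 1ℤ g 1ℤ cycle g-circ circ
      ; g-small = g′-small
      ; g-supp  = λ e e∉ → sum-0 (g-supp e (e∉ ∘ T⊆T′)) (cycle-off e e∉ (cycle e ℤ.≟ 0ℤ))
      }
      where
      in-S′ : ∀ e → e ∈ T ⊎ e ≡ entry ⊎ e ≡ exit ⊎ cycle e ≢ 0ℤ → Within S′ e
      in-S′ e (inj₁ e∈T) = within-mono (p⊆p∪q body) (T⊆S e∈T)
      in-S′ e (inj₂ (inj₁ refl)) =
        within d₁ entry (p⊆p∪q body from-S) (q⊆p∪q S body x∈body)
      in-S′ e (inj₂ (inj₂ (inj₁ refl))) =
        within d₂ exit (p⊆p∪q body to-S) (q⊆p∪q S body y∈body)
      in-S′ e (inj₂ (inj₂ (inj₂ c≢0))) with inside e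
      ... | inj₁ c≡0     = ⊥-elim (c≢0 c≡0)
      ... | inj₂ in-body = within-mono (q⊆p∪q S body) in-body

      reach′ : ∀ {w} → w ∈ S ⊎ w ∈ body → Path w
      reach′ (inj₁ w∈S) = widen (reach w∈S)
        where
        widen : ∀ {w} → ∃[ q ] (Carries q 1ℤ r w × (∀ e → e ∉ T → q e ≡ 0ℤ)) → Path w
        widen (q , carr , supp) = q , carr , λ e e∉ → supp e (e∉ ∘ T⊆T′)
      reach′ (inj₂ w∈body) = through (reach from-S) (spans w∈body)

      g′-small : ∀ e → Small (g′ e)
      g′-small e with e ∈? T
      ... | yes e∈T = subst Small (sym (1a+1·0 (T-off-body e∈T))) (g-small e)
      ... | no e∉T  = subst Small (sym (1·0+1b (g-supp e e∉T))) (values e)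

      cycle-off : ∀ e → e ∉ T′ → Dec (cycle e ≡ 0ℤ) → cycle e ≡ 0ℤ
      cycle-off e e∉ (yes c≡0) = c≡0
      cycle-off e e∉ (no c≢0)  = ⊥-elim (e∉ (cycle∈T′ c≢0))

    -- The correcting circulation runs from `r` through `S`, enters by `entry`, crosses the even
    -- subgraph, and returns along `exit` to `S` and `r`. The paths in `S` and in the body avoid
    -- both attaching edges, so its values there are ±1; `exit` is traversed towards `S`, whence
    -- `not d₂`.
    back : Completion T′ g′ → Completion T g
    back = close (reach from-S) (spans y∈body) (reach to-S)
      where
      close : ∃[ q ] (Carries q 1ℤ r (tl d₁ entry) × (∀ e → e ∉ T → q e ≡ 0ℤ)) →
              ∃[ p ] (Carries p 1ℤ (hd d₁ entry) (hd d₂ exit) ×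
                      (∀ e → p e ≡ 0ℤ ⊎ cycle e ≢ 0ℤ)) →
              ∃[ q ] (Carries q 1ℤ r (tl d₂ exit) × (∀ e → e ∉ T → q e ≡ 0ℤ)) →
              Completion T′ g′ → Completion T g
      close (q , q-carr , q-supp) (p , p-carr , p-supp) (q′ , q′-carr , q′-supp) =
        adjust T⊆T′ (λ e∈T → 1a+1·0 (T-off-body e∈T)) c c-circ c-off entry exit
          d₁ (not d₂) c-entry c-exit (λ e e∈ e∉ → only (T′⁻ e∈) e∉)
        where
        outbound : Chain
        outbound = combine 1ℤ (combine 1ℤ q 1ℤ (unit d₁ entry)) 1ℤ p

        return : Chain
        return = combine 1ℤ q′ 1ℤ (unit d₂ exit)

        c : Chain
        c = combine 1ℤ outbound (- 1ℤ) return

        c-circ : Circulation c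
        c-circ = carries-close 1ℤ outbound return
          (carries-++ (combine 1ℤ q 1ℤ (unit d₁ entry)) p
            (carries-++ q (unit d₁ entry) q-carr (unit-carries d₁ entry)) p-carr)
          (carries-++ q′ (unit d₂ exit) q′-carr (unit-carries d₂ exit))

        value : ∀ {q u p q′ u′ v v′} → q ≡ 0ℤ → u ≡ v → p ≡ 0ℤ → q′ ≡ 0ℤ → u′ ≡ v′ →
                1ℤ * (1ℤ * (1ℤ * q + 1ℤ * u) + 1ℤ * p) + (- 1ℤ) * (1ℤ * q′ + 1ℤ * u′)
                ≡ v - v′
        value {u = u} {u′ = u′} refl refl refl refl refl = lemma u u′
          where
          lemma : ∀ u u′ →
            1ℤ * (1ℤ * (1ℤ * 0ℤ + 1ℤ * u) + 1ℤ * 0ℤ) + (- 1ℤ) * (1ℤ * 0ℤ + 1ℤ * u′) ≡ u - u′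
          lemma = solve-∀

        p-off : ∀ d e → tl d e ∈ S → p e ≡ 0ℤ
        p-off d e t∈S with p-supp e
        ... | inj₁ p≡0 = p≡0
        ... | inj₂ c≢0 = ⊥-elim (c≢0 (off-body d e t∈S))

        c-entry : c entry ≡ sgn d₁
        c-entry = trans
          (value {v = sgn d₁} {v′ = 0ℤ} (q-supp entry entry∉T) (unit-on d₁ entry)
            (p-off d₁ entry from-S) (q′-supp entry entry∉T)
            (unit-off d₂ (entry≢exit ∘ sym)))
          (ℤ.+-identityʳ (sgn d₁))

        c-exit : c exit ≡ sgn (not d₂)
        c-exit = trans
          (value {v = 0ℤ} {v′ = sgn d₂} (q-supp exit exit∉T) (unit-off d₁ entry≢exit)
            (p-off d₂ exit to-S) (q′-supp exit exit∉T) (unit-on d₂ exit))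
          (trans (ℤ.+-identityˡ (- sgn d₂)) (sym (sgn-not d₂)))

        c-off : ∀ e → e ∉ T′ → c e ≡ 0ℤ
        c-off e e∉ = value {v = 0ℤ} {v′ = 0ℤ} (q-supp e (e∉ ∘ T⊆T′))
          (unit-off d₁ {entry} {e} (λ { refl → e∉ entry∈T′ })) (off-T′ {p} e (p-supp e) e∉)
          (q′-supp e (e∉ ∘ T⊆T′)) (unit-off d₂ {exit} {e} (λ { refl → e∉ exit∈T′ }))

        only : ∀ {e} → e ∈ T ⊎ e ≡ entry ⊎ e ≡ exit ⊎ cycle e ≢ 0ℤ → e ∉ T →
               e ≡ entry ⊎ e ≡ exit ⊎ g′ e ≢ 0ℤ
        only (inj₁ e∈T) e∉T                = ⊥-elim (e∉T e∈T)
        only (inj₂ (inj₁ e≡)) _            = inj₁ e≡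
        only (inj₂ (inj₂ (inj₁ e≡))) _     = inj₂ (inj₁ e≡)
        only {e} (inj₂ (inj₂ (inj₂ c≢0))) e∉T =
          inj₂ (inj₂ (λ g′≡0 → c≢0 (trans (sym (1·0+1b (g-supp e e∉T))) g′≡0)))

  -- Recursion as `T` grows: absorb an edge with both ends in `S`; if there is none, attach an ear.
  -- When `S` contains all vertices, `T` contains all edges and `f` = 0 will do. The corrections
  -- `back` are made on the way out, in reverse order.
  complete : ∀ {r} (K : Skeleton r) → Acc _⊃_ (Skeleton.T K) →
             Completion (Skeleton.T K) (Skeleton.g K)
  complete {r} K (acc rec) = by-edge (any? free?)
    where
    open Skeleton K

    Free : Edge G → Set
    Free e = e ∉ T × Within S e

    free? : ∀ e → Dec (Free e)
    free? e = ¬? (e ∈? T) ×-dec (src e ∈? S) ×-dec (tgt e ∈? S)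

    by-vertex : (∀ e → ¬ Free e) → Dec (∃[ v ] v ∉ S) → Completion T g
    by-vertex none (yes (v , v∉S)) = grow (ear r∈S v∉S)
      where
      grow : Ear S → Completion T g
      grow E = back (complete extended (rec (T⊆T′ , entry , entry∈T′ , entry∉T)))
        where
        open AddEar K E
        open Ear E using (entry)
    by-vertex none (no all) = record
      { g*       = g
      ; f        = λ _ → 0ℤ
      ; g*-circ  = g-circ
      ; f-circ   = circulation-zero
      ; g*-small = g-small
      ; agree    = λ _ → refl
      ; covered  = λ e e∉T → ⊥-elim (none e (e∉T , in-S (src e) , in-S (tgt e)))
      }
      where
      in-S : ∀ v → v ∈ S
      in-S v with v ∈? S
      ... | yes v∈S = v∈S
      ... | no v∉S  = ⊥-elim (all (v , v∉S))

    by-edge : Dec (∃[ e ] Free e) → Completion T g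
    by-edge (yes (e₀ , e₀∉T , e₀∈S)) =
      back (complete extended (rec (old , e₀ , q⊆p∪q T ⁅ e₀ ⁆ (x∈⁅x⁆ e₀) , e₀∉T)))
      where open AddEdge K e₀∉T e₀∈S
    by-edge (no none) = by-vertex (λ e fr → none (e , fr)) (any? (λ v → ¬? (v ∈? S)))

  seymour : Vertex G → Completion ∅ (λ _ → 0ℤ)
  seymour r = complete K (⊃-wellFounded ∅)
    where
    K : Skeleton r
    K = record
      { S       = ⁅ r ⁆
      ; T       = ∅
      ; g       = λ _ → 0ℤ
      ; T⊆S     = λ e∈ → ⊥-elim (∉⊥ e∈)
      ; r∈S     = x∈⁅x⁆ r
      ; reach   = at-root
      ; g-circ  = circulation-zero
      ; g-small = λ _ → nil
      ; g-supp  = λ _ _ → refl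
      }
      where
      at-root : ∀ {w} → w ∈ ⁅ r ⁆ → ∃[ q ] (Carries q 1ℤ r w × (∀ e → e ∉ ∅ → q e ≡ 0ℤ))
      at-root w∈ with refl ← x∈⁅y⁆⇒x≡y r w∈ = (λ _ → 0ℤ) , carries-zero , λ _ _ → refl

-- Four integer combinations of the flows.

-- The possible values of an integer 3-flow h = z + (h − z) split into two
-- flows with values 0, ±1 of equal signs.
data Split : ℤ → ℤ → Set where
  zero   : Split 0ℤ 0ℤ
  low    : ∀ d → Split (sgn d) 0ℤ
  high   : ∀ d → Split (sgn d) (sgn d)
  double : ∀ d → Split (+ 2 * sgn d) (sgn d)

-- From |2z| ≤ |h| + |h - 2z| ≤ 3 follows |z| ≤ 1, which leaves finitely many pairs.
split : ∀ h z → ℤ.∣ h ∣ ≤ 2 → ℤ.∣ h - + 2 * z ∣ ≤ 1 → Split h z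
split h z h≤2 gap≤1 = cases h (small z (ℕ.≮⇒≥ too-big)) h≤2 gap≤1
  where
  rearrange : ∀ h z → + 2 * z ≡ h - (h - + 2 * z)
  rearrange = solve-∀

  2∣z∣≤3 : 2 ℕ.* ℤ.∣ z ∣ ≤ 3
  2∣z∣≤3 = begin
    2 ℕ.* ℤ.∣ z ∣                      ≡⟨ ℤ.abs-* (+ 2) z ⟨
    ℤ.∣ + 2 * z ∣                      ≡⟨ cong ℤ.∣_∣ (rearrange h z) ⟩
    ℤ.∣ h - (h - + 2 * z) ∣            ≤⟨ ℤ.∣i-j∣≤∣i∣+∣j∣ h (h - + 2 * z) ⟩
    ℤ.∣ h ∣ ℕ.+ ℤ.∣ h - + 2 * z ∣      ≤⟨ ℕ.+-mono-≤ h≤2 gap≤1 ⟩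
    3                                  ∎
    where open ℕ.≤-Reasoning

  too-big : ¬ 1 < ℤ.∣ z ∣
  too-big 1<z = ℕ.<-irrefl refl (ℕ.≤-trans (ℕ.*-monoʳ-≤ 2 1<z) 2∣z∣≤3)

  cases : ∀ h {z} → Small z → ℤ.∣ h ∣ ≤ 2 → ℤ.∣ h - + 2 * z ∣ ≤ 1 → Split h z
  cases (+ 0)    nil         _ _ = zero
  cases (+ 1)    nil         _ _ = low true
  cases -[1+ 0 ] nil         _ _ = low false
  cases (+ 1)    (one true)  _ _ = high true
  cases -[1+ 0 ] (one false) _ _ = high false
  cases (+ 2)    (one true)  _ _ = double true
  cases -[1+ 1 ] (one false) _ _ = double false
  cases (+ 2)    nil         _ (s≤s ())
  cases -[1+ 1 ] nil         _ (s≤s ())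
  cases (+ 0)    (one true)  _ (s≤s ())
  cases (+ 0)    (one false) _ (s≤s ())
  cases (+ 1)    (one false) _ (s≤s ())
  cases (+ 2)    (one false) _ (s≤s ())
  cases -[1+ 0 ] (one true)  _ (s≤s ())
  cases -[1+ 1 ] (one true)  _ (s≤s ())
  cases (+ suc (suc (suc _))) _ (s≤s (s≤s ())) _
  cases -[1+ suc (suc _) ]    _ (s≤s (s≤s ())) _

-- On every admissible triple all four are nonzero and one is ±1.
F₁ F₂ F₃ F₄ : ℤ → ℤ → ℤ → ℤ
F₁ g h z = 1ℤ * g + + 2 * h
F₂ g h z = + 3 * g + 1ℤ * h
F₃ g h z = + 3 * g + -[1+ 1 ] * h
F₄ g h z = 1ℤ * (+ 2 * g + -[1+ 3 ] * h) + + 7 * z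

Good : ℤ → ℤ → ℤ → Set
Good g h z =
  (F₁ g h z ≢ 0ℤ × F₂ g h z ≢ 0ℤ × F₃ g h z ≢ 0ℤ × F₄ g h z ≢ 0ℤ) ×
  (ℤ.∣ F₁ g h z ∣ ≡ 1 ⊎ ℤ.∣ F₂ g h z ∣ ≡ 1 ⊎ ℤ.∣ F₃ g h z ∣ ≡ 1 ⊎ ℤ.∣ F₄ g h z ∣ ≡ 1)

good? : ∀ g h z → Dec (Good g h z)
good? g h z =
  (nonzero? (F₁ g h z) ×-dec nonzero? (F₂ g h z) ×-dec
   nonzero? (F₃ g h z) ×-dec nonzero? (F₄ g h z)) ×-dec
  (unit? (F₁ g h z) ⊎-dec unit? (F₂ g h z) ⊎-dec unit? (F₃ g h z) ⊎-dec unit? (F₄ g h z))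
  where
  nonzero? : ∀ a → Dec (a ≢ 0ℤ)
  nonzero? a = ¬? (a ℤ.≟ 0ℤ)

  unit? : ∀ a → Dec (ℤ.∣ a ∣ ≡ 1)
  unit? a = ℤ.∣ a ∣ ℕ.≟ 1

good : ∀ {g h z} → Small g → Split h z → g ≢ 0ℤ ⊎ h ≢ 0ℤ → Good g h z
good nil zero (inj₁ g≢0) = ⊥-elim (g≢0 refl)
good nil zero (inj₂ h≢0) = ⊥-elim (h≢0 refl)
good (one true) zero _ = Dec.from-yes (good? (sgn true) 0ℤ 0ℤ)
good (one false) zero _ = Dec.from-yes (good? (sgn false) 0ℤ 0ℤ)
good nil (low true) _ = Dec.from-yes (good? 0ℤ (sgn true) 0ℤ)
good nil (low false) _ = Dec.from-yes (good? 0ℤ (sgn false) 0ℤ)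
good (one true) (low true) _ = Dec.from-yes (good? (sgn true) (sgn true) 0ℤ)
good (one true) (low false) _ = Dec.from-yes (good? (sgn true) (sgn false) 0ℤ)
good (one false) (low true) _ = Dec.from-yes (good? (sgn false) (sgn true) 0ℤ)
good (one false) (low false) _ = Dec.from-yes (good? (sgn false) (sgn false) 0ℤ)
good nil (high true) _ = Dec.from-yes (good? 0ℤ (sgn true) (sgn true))
good nil (high false) _ = Dec.from-yes (good? 0ℤ (sgn false) (sgn false))
good (one true) (high true) _ = Dec.from-yes (good? (sgn true) (sgn true) (sgn true))
good (one true) (high false) _ = Dec.from-yes (good? (sgn true) (sgn false) (sgn false))
good (one false) (high true) _ = Dec.from-yes (good? (sgn false) (sgn true) (sgn true))
good (one false) (high false) _ = Dec.from-yes (good? (sgn false) (sgn false) (sgn false))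
-- Only for g = 0 and |h| = 2 do the first three forms miss ±1: their absolute values are 4, 2, 4.
-- The fourth form serves this case, being -8 + 7 = -1 up to sign.
good nil (double true) _ = Dec.from-yes (good? 0ℤ (+ 2 * sgn true) (sgn true))
good nil (double false) _ = Dec.from-yes (good? 0ℤ (+ 2 * sgn false) (sgn false))
good (one true) (double true) _ = Dec.from-yes (good? (sgn true) (+ 2 * sgn true) (sgn true))
good (one true) (double false) _ = Dec.from-yes (good? (sgn true) (+ 2 * sgn false) (sgn false))
good (one false) (double true) _ = Dec.from-yes (good? (sgn false) (+ 2 * sgn true) (sgn true))
good (one false) (double false) _ = Dec.from-yes (good? (sgn false) (+ 2 * sgn false) (sgn false))

-- Decidability, and the existence of a least family.

least : ∀ {P : ℕ → Set} → (∀ n → Dec (P n)) → ∀ n → P n →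
        ∃[ k ] ((P k × (∀ j → P j → k ≤ j)) × k ≤ n)
least {P} P? n p = descend n p (<-wellFounded n)
  where
  descend : ∀ n → P n → Acc _<_ n → ∃[ k ] ((P k × (∀ j → P j → k ≤ j)) × k ≤ n)
  descend n p (acc rec) with ℕ.anyUpTo? P? n
  ... | no none = n , (p , λ j pj → ℕ.≮⇒≥ (λ j<n → none (j , j<n , pj))) , ℕ.≤-refl
  ... | yes (m , m<n , pm) with descend m pm (rec m<n)
  ...   | k , min , k≤m = k , min , ℕ.≤-trans k≤m (ℕ.<⇒≤ m<n)

module Decidability (G : Graph) where
  open Darts G

  strong? : ∀ F o → Dec (Strong G F o)
  strong? F o = all? (λ u → all? (λ v → ¬? (u ≟ v) →-dec reachable? u v))
    where
    Allowed : Bool → Edge G → Set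
    Allowed d e = e ∈ F × lookup o e ≡ d

    allowed? : ∀ d e → Dec (Allowed d e)
    allowed? d e = (e ∈? F) ×-dec (lookup o e ≟ᵇ d)

    reachable? : ∀ u v → Dec (Star (Arc G F o) u v)
    reachable? u v = answer search
      where
      open Search allowed? u

      to-arc : ∀ {a b} → Step a b → Arc G F o a b
      to-arc (d , e , (e∈F , refl) , eq) = e , e∈F , eq

      from-arc : ∀ {a b} → Arc G F o a b → Step a b
      from-arc (e , e∈F , eq) = lookup o e , e , (e∈F , refl) , eq

      answer : ∃[ R ] (Reached R × Closed R) → Dec (Star (Arc G F o) u v)
      answer (R , reached , closed) with v ∈? R
      ... | yes v∈R = yes (map to-arc (reached-walk reached v∈R))
      ... | no v∉R  = no (λ walk →
              v∉R (walk-closed closed (root∈ reached) (map from-arc walk)))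

  anyFamily? : ∀ k {P : Vec (Orientation G) k → Set} → (∀ os → Dec (P os)) →
               Dec (∃[ os ] P os)
  anyFamily? zero P? = Dec.map′ ([] ,_) (λ { ([] , p) → p }) (P? [])
  anyFamily? (suc k) P? =
    Dec.map′ (λ { (o , os , p) → o ∷ os , p }) (λ { (o ∷ os , p) → o , os , p })
      -- An orientation and a set of edges are both Boolean vectors of length `size G`, so a search
      -- over subsets is a search over orientations.
      (anySubset? (λ o → anyFamily? k (λ os → P? (o ∷ os))))

  -- `IsFrankNumber` asks for a minimum that is attained; with this decision `least` finds it
  -- constructively below a given bound.
  admits? : ∀ k → Dec (AdmitsFrankFamily G k)
  admits? k = anyFamily? k
    (λ os → all? (λ e → Any.any? (λ o → strong? (∁ ⁅ e ⁆) o) os))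

-- Assembling the four orientations.

module Family (G : Graph) (conn : EdgeConnected 3 G) where
  open Flux G
  open Positive G
  open Cut conn
  open Growth G conn

  family : ∀ g h z → Circulation g → Circulation h → Circulation z →
           (∀ e → Good (g e) (h e) (z e)) → AdmitsFrankFamily G 4
  family g h z g-circ h-circ z-circ good =
    orient f₁ ∷ orient f₂ ∷ orient f₃ ∷ orient f₄ ∷ [] , λ e → cover e (good e)
    where
    f₁ f₂ f₃ f₄ : Chain
    f₁ = combine 1ℤ g (+ 2) h
    f₂ = combine (+ 3) g 1ℤ h
    f₃ = combine (+ 3) g -[1+ 1 ] h
    f₄ = combine 1ℤ (combine (+ 2) g -[1+ 3 ] h) (+ 7) z

    c₁ : Circulation f₁
    c₁ = circulation-combine 1ℤ g (+ 2) h g-circ h-circ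
    c₂ : Circulation f₂
    c₂ = circulation-combine (+ 3) g 1ℤ h g-circ h-circ
    c₃ : Circulation f₃
    c₃ = circulation-combine (+ 3) g -[1+ 1 ] h g-circ h-circ
    c₄ : Circulation f₄
    c₄ = circulation-combine 1ℤ (combine (+ 2) g -[1+ 3 ] h) (+ 7) z
           (circulation-combine (+ 2) g -[1+ 3 ] h g-circ h-circ) z-circ

    cover : ∀ e → Good (g e) (h e) (z e) →
            Any (λ o → Deletable G o e) (orient f₁ ∷ orient f₂ ∷ orient f₃ ∷ orient f₄ ∷ [])
    cover e (_ , inj₁ u) =
      here (deletable f₁ c₁ (λ e → proj₁ (proj₁ (good e))) e u)
    cover e (_ , inj₂ (inj₁ u)) =
      there (here (deletable f₂ c₂ (λ e → proj₁ (proj₂ (proj₁ (good e)))) e u))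
    cover e (_ , inj₂ (inj₂ (inj₁ u))) =
      there (there (here (deletable f₃ c₃ (λ e → proj₁ (proj₂ (proj₂ (proj₁ (good e))))) e u)))
    cover e (_ , inj₂ (inj₂ (inj₂ u))) =
      there (there (there (here
        (deletable f₄ c₄ (λ e → proj₂ (proj₂ (proj₂ (proj₁ (good e))))) e u))))

  from-completion : Completion ∅ (λ _ → 0ℤ) → AdmitsFrankFamily G 4
  from-completion K = mod3 (reduce (+ 3) 2 refl f f-circ)
    where
    open Completion K

    mod3 : Reduced (+ 3) 2 f → AdmitsFrankFamily G 4
    mod3 (y , y-circ , h≤2) = mod2 (reduce (+ 2) 1 refl h h-circ)
      where
      h : Chain
      h = combine 1ℤ f (- (+ 3)) y

      h-circ : Circulation h
      h-circ = circulation-combine 1ℤ f (- (+ 3)) y f-circ y-circ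

      h≡ : ∀ e → h e ≡ f e - + 3 * y e
      h≡ e = lemma (f e) (y e)
        where
        lemma : ∀ a b → 1ℤ * a + (- (+ 3)) * b ≡ a - + 3 * b
        lemma = solve-∀

      -- `h` and `f` are congruent modulo 3, so a zero of `h` would make `f` divisible by 3 there.
      h≢0 : ∀ e → ¬ (+ 3 Div.∣ f e) → h e ≢ 0ℤ
      h≢0 e 3∤f h≡0 = 3∤f (Div.divides (y e)
        (trans (ℤ.i-j≡0⇒i≡j (f e) (+ 3 * y e) (trans (sym (h≡ e)) h≡0)) (ℤ.*-comm (+ 3) (y e))))

      covered′ : ∀ e → g* e ≢ 0ℤ ⊎ h e ≢ 0ℤ
      covered′ e with covered e ∉⊥
      ... | inj₁ g≢0 = inj₁ g≢0
      ... | inj₂ 3∤f = inj₂ (h≢0 e 3∤f)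

      mod2 : Reduced (+ 2) 1 h → AdmitsFrankFamily G 4
      mod2 (z , z-circ , gap≤1) = family g* h z g*-circ h-circ z-circ
        (λ e → good (g*-small e)
          (split (h e) (z e) (subst (λ a → ℤ.∣ a ∣ ≤ 2) (sym (h≡ e)) (h≤2 e)) (gap≤1 e))
          (covered′ e))

  admits-4 : AdmitsFrankFamily G 4
  admits-4 = rooted (any? (λ (_ : Vertex G) → yes tt))
    where
    rooted : Dec (∃[ r ] ⊤) → AdmitsFrankFamily G 4
    rooted (yes (r , _)) = from-completion (seymour r)
    -- Without vertices there is no root to grow from, but every orientation is vacuously strong.
    rooted (no empty)    =
      replicate 4 (replicate (size G) true) , λ e → here (λ u → ⊥-elim (empty (u , tt)))

theorem1 : (G : Graph) → EdgeConnected 3 G → ∃[ k ] (IsFrankNumber G k × k ≤ 4)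
theorem1 G conn = least (Decidability.admits? G) 4 (Family.admits-4 G conn)
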